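{- Let $n$ be a positive odd integer. Then, modulo $(1-aq^n)(a-q^n)$, $$ \sum_{k=0}^{n-1}\frac{(aq;q^2)_k\,(q/a;q^2)_k}{(q^2;q^2)_k^2}\, x^k \equiv \sum_{k=0}^{(n-1)/2}{(n-1)/2\brack k}_{q^2}^2 q^{k^2-nk} (-x)^k\, (x;q^2)_{(n-1)/2-k}. $$
   Context: $a,q,x$ are indeterminates. The $q$-shifted factorial is $(y;q)_0=1$ and $(y;q)_m=(1-y)(1-yq)\cdots(1-yq^{m-1})$ for $m\geqslant1$. The $q$-binomial coefficient is ${N\brack k}_q=\frac{(q;q)_N}{(q;q)_k(q;q)_{N-k}}$ for $0\leqslant k\leqslant N$ and $0$ otherwise; ${N\brack k}_{q^2}$ is this with $q$ replaced by $q^2$. For rational functions $A,B$ and a polynomial $P$, $A\equiv B\pmod P$ means $A-B=P\cdot C/D$ for polynomials $C,D$ with $D$ coprime to $P$. -}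

module Defs where

open import Algebra.Bundles using (CommutativeRing; Semiring)
open import Data.Bool.Base using (if_then_else_)
open import Data.Integer.Base using (ℤ; +_; -[1+_])
open import Data.List.Base using (List; []; _∷_; map)
open import Data.Nat.Base as ℕ using (ℕ; zero; suc; _∸_)
open import Data.Nat.Properties using (_≤?_)
open import Data.Product.Base using (Σ-syntax; _×_; _,_)
open import Data.Rational.Base as ℚ using (ℚ; 0ℚ; 1ℚ)
import Data.Rational.Properties as ℚₚ
open import Data.Sum.Base using (_⊎_; inj₁; inj₂)
open import Level using (Level; _⊔_; 0ℓ) renaming (suc to lsuc)
open import Relation.Binary.Definitions using (Decidable)
open import Relation.Binary.PropositionalEquality as ≡ using (_≡_)
open import Relation.Nullary using (¬_; Dec; does; yes; no; contradiction)
open import Algebra.Structures using (IsCommutativeRing)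
import Algebra.Definitions.RawSemiring as RawSemiringDefinitions
import Algebra.Properties.Ring as RingProperties
import Algebra.Solver.Ring.NaturalCoefficients.Default as Solver
import Relation.Binary.Reasoning.Setoid as SetoidReasoning

record IntegralDomain (c ℓ : Level) : Set (lsuc (c ⊔ ℓ)) where
  field
    commutativeRing : CommutativeRing c ℓ
  open CommutativeRing commutativeRing public
  field
    _≟_          : Decidable _≈_
    1≉0          : ¬ (1# ≈ 0#)
    zero-product : ∀ {x y} → x * y ≈ 0# → x ≈ 0# ⊎ y ≈ 0#

  *-nonzero : ∀ {x y} → ¬ (x ≈ 0#) → ¬ (y ≈ 0#) → ¬ (x * y ≈ 0#)
  *-nonzero x≉0 y≉0 xy≈0 with zero-product xy≈0
  ... | inj₁ x≈0 = x≉0 x≈0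
  ... | inj₂ y≈0 = y≉0 y≈0

ℚ-integralDomain : IntegralDomain 0ℓ 0ℓ
ℚ-integralDomain = record
  { commutativeRing = ℚₚ.+-*-commutativeRing
  ; _≟_             = ℚₚ._≟_
  ; 1≉0             = λ ()
  ; zero-product    = λ {p} {r} → zp p r
  }
  where
  zp : ∀ p r → p ℚ.* r ≡ 0ℚ → p ≡ 0ℚ ⊎ r ≡ 0ℚ
  zp p r pr≡0 with p ℚₚ.≟ 0ℚ
  ... | yes p≡0 = inj₁ p≡0
  ... | no  p≢0 = inj₂ (begin
    r                      ≡⟨ ≡.sym (ℚₚ.*-identityˡ r) ⟩
    1ℚ ℚ.* r               ≡⟨ ≡.cong (ℚ._* r) (≡.sym (ℚₚ.*-inverseˡ p)) ⟩
    ((ℚ.1/ p) ℚ.* p) ℚ.* r ≡⟨ ℚₚ.*-assoc (ℚ.1/ p) p r ⟩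
    (ℚ.1/ p) ℚ.* (p ℚ.* r) ≡⟨ ≡.cong ((ℚ.1/ p) ℚ.*_) pr≡0 ⟩
    (ℚ.1/ p) ℚ.* 0ℚ        ≡⟨ ℚₚ.*-zeroʳ (ℚ.1/ p) ⟩
    0ℚ                     ∎)
    where
    open ≡.≡-Reasoning
    instance
      p-nonZero : ℚ.NonZero p
      p-nonZero = ℚ.≢-nonZero p≢0

-- Univariate polynomials as coefficient lists, constant term first.  Trailing
-- zeros are allowed, so equality is equality of all coefficients.
module Polynomials {c ℓ : Level} (D : IntegralDomain c ℓ) where

  open IntegralDomain D
  open RingProperties ring using (-0#≈0#)

  Poly : Set c
  Poly = List Carrier

  coeff : Poly → ℕ → Carrier
  coeff []      _       = 0#
  coeff (a ∷ p) zero    = a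
  coeff (a ∷ p) (suc i) = coeff p i

  infix 4 _≋_
  record _≋_ (p r : Poly) : Set ℓ where
    constructor mk≋
    field coeff≈ : ∀ i → coeff p i ≈ coeff r i
  open _≋_ public

  infixl 6 _+ₚ_
  infixl 7 _*ₚ_ _·_

  _+ₚ_ : Poly → Poly → Poly
  []      +ₚ r       = r
  (a ∷ p) +ₚ []      = a ∷ p
  (a ∷ p) +ₚ (b ∷ r) = (a + b) ∷ (p +ₚ r)

  -ₚ_ : Poly → Poly
  -ₚ_ = map (-_)

  _·_ : Carrier → Poly → Poly
  a · p = map (a *_) p

  _*ₚ_ : Poly → Poly → Poly
  []      *ₚ r = []
  (a ∷ p) *ₚ r = a · r +ₚ (0# ∷ p *ₚ r)

  constant : Carrier → Poly
  constant a = a ∷ []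

  X : Poly
  X = 0# ∷ 1# ∷ []

  open SetoidReasoning setoid

  coeff-+ : ∀ p r i → coeff (p +ₚ r) i ≈ coeff p i + coeff r i
  coeff-+ []      r       i       = sym (+-identityˡ _)
  coeff-+ (a ∷ p) []      i       = sym (+-identityʳ _)
  coeff-+ (a ∷ p) (b ∷ r) zero    = refl
  coeff-+ (a ∷ p) (b ∷ r) (suc i) = coeff-+ p r i

  coeff-neg : ∀ p i → coeff (-ₚ p) i ≈ - coeff p i
  coeff-neg []      i       = sym -0#≈0#
  coeff-neg (a ∷ p) zero    = refl
  coeff-neg (a ∷ p) (suc i) = coeff-neg p i

  coeff-· : ∀ a p i → coeff (a · p) i ≈ a * coeff p i
  coeff-· a []      i       = sym (zeroʳ a)
  coeff-· a (b ∷ p) zero    = refl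
  coeff-· a (b ∷ p) (suc i) = coeff-· a p i

  ≋-refl : ∀ {p} → p ≋ p
  ≋-refl = mk≋ λ _ → refl

  ≋-sym : ∀ {p r} → p ≋ r → r ≋ p
  ≋-sym e = mk≋ λ i → sym (coeff≈ e i)

  ≋-trans : ∀ {p r s} → p ≋ r → r ≋ s → p ≋ s
  ≋-trans e f = mk≋ λ i → trans (coeff≈ e i) (coeff≈ f i)

  ∷-cong : ∀ {a b p r} → a ≈ b → p ≋ r → (a ∷ p) ≋ (b ∷ r)
  ∷-cong a≈b p≋r = mk≋ λ { zero → a≈b ; (suc i) → coeff≈ p≋r i }

  ∷-zero : ∀ {a p} → a ≈ 0# → p ≋ [] → (a ∷ p) ≋ []
  ∷-zero a≈0 p≋0 = mk≋ λ { zero → a≈0 ; (suc i) → coeff≈ p≋0 i }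

  tail-zero : ∀ {a p} → (a ∷ p) ≋ [] → p ≋ []
  tail-zero e = mk≋ λ i → coeff≈ e (suc i)

  +-cong′ : ∀ {p p′ r r′} → p ≋ p′ → r ≋ r′ → (p +ₚ r) ≋ (p′ +ₚ r′)
  +-cong′ {p} {p′} {r} {r′} e f = mk≋ λ i →
    trans (coeff-+ p r i) (trans (+-cong (coeff≈ e i) (coeff≈ f i)) (sym (coeff-+ p′ r′ i)))

  +-assoc′ : ∀ p r s → ((p +ₚ r) +ₚ s) ≋ (p +ₚ (r +ₚ s))
  +-assoc′ p r s = mk≋ λ i → begin
    coeff ((p +ₚ r) +ₚ s) i               ≈⟨ coeff-+ (p +ₚ r) s i ⟩
    coeff (p +ₚ r) i + coeff s i          ≈⟨ +-congʳ (coeff-+ p r i) ⟩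
    (coeff p i + coeff r i) + coeff s i   ≈⟨ +-assoc _ _ _ ⟩
    coeff p i + (coeff r i + coeff s i)   ≈⟨ +-congˡ (coeff-+ r s i) ⟨
    coeff p i + coeff (r +ₚ s) i          ≈⟨ coeff-+ p (r +ₚ s) i ⟨
    coeff (p +ₚ (r +ₚ s)) i               ∎

  +-comm′ : ∀ p r → (p +ₚ r) ≋ (r +ₚ p)
  +-comm′ p r = mk≋ λ i →
    trans (coeff-+ p r i) (trans (+-comm _ _) (sym (coeff-+ r p i)))

  +-identityʳ′ : ∀ p → (p +ₚ []) ≋ p
  +-identityʳ′ p = mk≋ λ i → trans (coeff-+ p [] i) (+-identityʳ _)

  neg-cong′ : ∀ {p r} → p ≋ r → (-ₚ p) ≋ (-ₚ r)
  neg-cong′ {p} {r} e = mk≋ λ i →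
    trans (coeff-neg p i) (trans (-‿cong (coeff≈ e i)) (sym (coeff-neg r i)))

  neg-inverseʳ′ : ∀ p → (p +ₚ (-ₚ p)) ≋ []
  neg-inverseʳ′ p = mk≋ λ i →
    trans (coeff-+ p (-ₚ p) i) (trans (+-congˡ (coeff-neg p i)) (-‿inverseʳ _))

  +-interchange : ∀ p r s t → ((p +ₚ r) +ₚ (s +ₚ t)) ≋ ((p +ₚ s) +ₚ (r +ₚ t))
  +-interchange p r s t =
    ≋-trans (+-assoc′ p r (s +ₚ t))
    (≋-trans (+-cong′ (≋-refl {p})
      (≋-trans (≋-sym (+-assoc′ r s t))
      (≋-trans (+-cong′ (+-comm′ r s) (≋-refl {t}))
               (+-assoc′ s r t))))
    (≋-sym (+-assoc′ p s (r +ₚ t))))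

  ·-cong : ∀ {a b p r} → a ≈ b → p ≋ r → (a · p) ≋ (b · r)
  ·-cong {a} {b} {p} {r} a≈b e = mk≋ λ i →
    trans (coeff-· a p i) (trans (*-cong a≈b (coeff≈ e i)) (sym (coeff-· b r i)))

  ·-zero : ∀ {a} p → a ≈ 0# → (a · p) ≋ []
  ·-zero {a} p a≈0 = mk≋ λ i →
    trans (coeff-· a p i) (trans (*-congʳ a≈0) (zeroˡ _))

  ·-distribˡ : ∀ a p r → (a · (p +ₚ r)) ≋ (a · p +ₚ a · r)
  ·-distribˡ a p r = mk≋ λ i → begin
    coeff (a · (p +ₚ r)) i                ≈⟨ coeff-· a (p +ₚ r) i ⟩
    a * coeff (p +ₚ r) i                  ≈⟨ *-congˡ (coeff-+ p r i) ⟩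
    a * (coeff p i + coeff r i)           ≈⟨ distribˡ _ _ _ ⟩
    a * coeff p i + a * coeff r i         ≈⟨ +-cong (coeff-· a p i) (coeff-· a r i) ⟨
    coeff (a · p) i + coeff (a · r) i     ≈⟨ coeff-+ (a · p) (a · r) i ⟨
    coeff (a · p +ₚ a · r) i              ∎

  ·-distribʳ : ∀ p a b → ((a + b) · p) ≋ (a · p +ₚ b · p)
  ·-distribʳ p a b = mk≋ λ i → begin
    coeff ((a + b) · p) i                 ≈⟨ coeff-· (a + b) p i ⟩
    (a + b) * coeff p i                   ≈⟨ distribʳ _ _ _ ⟩
    a * coeff p i + b * coeff p i         ≈⟨ +-cong (coeff-· a p i) (coeff-· b p i) ⟨
    coeff (a · p) i + coeff (b · p) i     ≈⟨ coeff-+ (a · p) (b · p) i ⟨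
    coeff (a · p +ₚ b · p) i              ∎

  ·-assoc : ∀ a b p → ((a * b) · p) ≋ (a · (b · p))
  ·-assoc a b p = mk≋ λ i → begin
    coeff ((a * b) · p) i   ≈⟨ coeff-· (a * b) p i ⟩
    (a * b) * coeff p i     ≈⟨ *-assoc _ _ _ ⟩
    a * (b * coeff p i)     ≈⟨ *-congˡ (coeff-· b p i) ⟨
    a * coeff (b · p) i     ≈⟨ coeff-· a (b · p) i ⟨
    coeff (a · (b · p)) i   ∎

  ·-identity : ∀ p → (1# · p) ≋ p
  ·-identity p = mk≋ λ i → trans (coeff-· 1# p i) (*-identityˡ _)

  shift-+ : ∀ p r → (0# ∷ (p +ₚ r)) ≋ ((0# ∷ p) +ₚ (0# ∷ r))
  shift-+ p r = ∷-cong (sym (+-identityˡ 0#)) ≋-refl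

  *-congˡ′ : ∀ p {r r′} → r ≋ r′ → (p *ₚ r) ≋ (p *ₚ r′)
  *-congˡ′ []      e = ≋-refl
  *-congˡ′ (a ∷ p) e = +-cong′ (·-cong refl e) (∷-cong refl (*-congˡ′ p e))

  *-zeroʳ′ : ∀ p → (p *ₚ []) ≋ []
  *-zeroʳ′ []      = ≋-refl
  *-zeroʳ′ (a ∷ p) = ∷-zero refl (*-zeroʳ′ p)

  *-∷ : ∀ p b r → (p *ₚ (b ∷ r)) ≋ (b · p +ₚ (0# ∷ p *ₚ r))
  *-∷ []      b r = ≋-sym (∷-zero refl ≋-refl)
  *-∷ (a ∷ p) b r = ∷-cong (+-congʳ (*-comm a b))
    (≋-trans (+-cong′ (≋-refl {a · r}) (*-∷ p b r))
    (≋-trans (≋-sym (+-assoc′ (a · r) (b · p) (0# ∷ p *ₚ r)))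
    (≋-trans (+-cong′ (+-comm′ (a · r) (b · p)) ≋-refl)
             (+-assoc′ (b · p) (a · r) (0# ∷ p *ₚ r)))))

  *-comm′ : ∀ p r → (p *ₚ r) ≋ (r *ₚ p)
  *-comm′ []      r = ≋-sym (*-zeroʳ′ r)
  *-comm′ (a ∷ p) r =
    ≋-trans (+-cong′ (≋-refl {a · r}) (∷-cong refl (*-comm′ p r)))
            (≋-sym (*-∷ r a p))

  *-cong′ : ∀ {p p′ r r′} → p ≋ p′ → r ≋ r′ → (p *ₚ r) ≋ (p′ *ₚ r′)
  *-cong′ {p} {p′} {r} {r′} e f =
    ≋-trans (*-congˡ′ p f)
    (≋-trans (*-comm′ p r′) (≋-trans (*-congˡ′ r′ e) (*-comm′ r′ p′)))

  *-distribʳ′ : ∀ s p r → ((p +ₚ r) *ₚ s) ≋ (p *ₚ s +ₚ r *ₚ s)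
  *-distribʳ′ s []      r       = ≋-refl
  *-distribʳ′ s (a ∷ p) []      = ≋-sym (+-identityʳ′ ((a ∷ p) *ₚ s))
  *-distribʳ′ s (a ∷ p) (b ∷ r) =
    ≋-trans (+-cong′ (·-distribʳ s a b)
      (≋-trans (∷-cong refl (*-distribʳ′ s p r)) (shift-+ (p *ₚ s) (r *ₚ s))))
    (+-interchange (a · s) (b · s) (0# ∷ p *ₚ s) (0# ∷ r *ₚ s))

  *-distribˡ′ : ∀ s p r → (s *ₚ (p +ₚ r)) ≋ (s *ₚ p +ₚ s *ₚ r)
  *-distribˡ′ s p r =
    ≋-trans (*-comm′ s (p +ₚ r))
    (≋-trans (*-distribʳ′ s p r) (+-cong′ (*-comm′ p s) (*-comm′ r s)))

  shift-* : ∀ p r → ((0# ∷ p) *ₚ r) ≋ (0# ∷ p *ₚ r)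
  shift-* p r = +-cong′ (·-zero r refl) (≋-refl {0# ∷ p *ₚ r})

  ·-* : ∀ a p r → ((a · p) *ₚ r) ≋ (a · (p *ₚ r))
  ·-* a []      r = ≋-refl
  ·-* a (b ∷ p) r =
    ≋-trans (+-cong′ (·-assoc a b r) (∷-cong (sym (zeroʳ a)) (·-* a p r)))
            (≋-sym (·-distribˡ a (b · r) (0# ∷ p *ₚ r)))

  *-assoc′ : ∀ p r s → ((p *ₚ r) *ₚ s) ≋ (p *ₚ (r *ₚ s))
  *-assoc′ []      r s = ≋-refl
  *-assoc′ (a ∷ p) r s =
    ≋-trans (*-distribʳ′ s (a · r) (0# ∷ p *ₚ r))
    (+-cong′ (·-* a r s)
      (≋-trans (shift-* (p *ₚ r) s) (∷-cong refl (*-assoc′ p r s))))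

  *-identityˡ′ : ∀ p → (constant 1# *ₚ p) ≋ p
  *-identityˡ′ p =
    ≋-trans (+-cong′ (·-identity p) (∷-zero {0#} {[]} refl ≋-refl)) (+-identityʳ′ p)

  zero? : ∀ p → Dec (p ≋ [])
  zero? []      = yes ≋-refl
  zero? (a ∷ p) with a ≟ 0# | zero? p
  ... | yes a≈0 | yes p≋0 = yes (∷-zero a≈0 p≋0)
  ... | no  a≉0 | _       = no λ e → a≉0 (coeff≈ e 0)
  ... | yes _   | no  p≄0 = no λ e → p≄0 (tail-zero e)

  ≋? : ∀ p r → Dec (p ≋ r)
  ≋? []      r       with zero? r
  ... | yes r≋0 = yes (≋-sym r≋0)
  ... | no  r≄0 = no λ e → r≄0 (≋-sym e)
  ≋? (a ∷ p) []      = zero? (a ∷ p)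
  ≋? (a ∷ p) (b ∷ r) with a ≟ b | ≋? p r
  ... | yes a≈b | yes p≋r = yes (∷-cong a≈b p≋r)
  ... | no  a≉b | _       = no λ e → a≉b (coeff≈ e 0)
  ... | yes _   | no  p≄r = no λ e → p≄r (mk≋ λ i → coeff≈ e (suc i))

  cancelˡ-∷ : ∀ {a} p r → ¬ (a ≈ 0#) → ((a ∷ p) *ₚ r) ≋ [] → r ≋ []
  cancelˡ-∷ p []      a≉0 e = ≋-refl
  cancelˡ-∷ {a} p (b ∷ r) a≉0 e = ∷-zero b≈0 (cancelˡ-∷ p r a≉0 ap*r≋0)
    where
    b≈0 : b ≈ 0#
    b≈0 with zero-product (trans (sym (+-identityʳ (a * b))) (coeff≈ e 0))
    ... | inj₁ a≈0   = contradiction a≈0 a≉0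
    ... | inj₂ b≈0′ = b≈0′
    ap*r≋0 : ((a ∷ p) *ₚ r) ≋ []
    ap*r≋0 = tail-zero
      (≋-trans (≋-sym (≋-trans (*-∷ (a ∷ p) b r)
                 (+-cong′ (·-zero (a ∷ p) b≈0) (≋-refl {0# ∷ (a ∷ p) *ₚ r})))) e)

  zero-product′ : ∀ p r → (p *ₚ r) ≋ [] → (p ≋ []) ⊎ (r ≋ [])
  zero-product′ []      r e = inj₁ ≋-refl
  zero-product′ (a ∷ p) r e with a ≟ 0#
  ... | no  a≉0 = inj₂ (cancelˡ-∷ p r a≉0 e)
  ... | yes a≈0 with zero-product′ p r (tail-zero
          (≋-trans (≋-sym (+-cong′ (·-zero r a≈0) (≋-refl {0# ∷ p *ₚ r}))) e))
  ...   | inj₁ p≋0 = inj₁ (∷-zero a≈0 p≋0)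
  ...   | inj₂ r≋0 = inj₂ r≋0

  abstract
    polynomial-isCommutativeRing : IsCommutativeRing _≋_ _+ₚ_ _*ₚ_ -ₚ_ [] (constant 1#)
    polynomial-isCommutativeRing = record
      { isRing = record
        { +-isAbelianGroup = record
          { isGroup = record
            { isMonoid = record
              { isSemigroup = record
                { isMagma = record
                  { isEquivalence = record { refl = ≋-refl ; sym = ≋-sym ; trans = ≋-trans }
                  ; ∙-cong = +-cong′
                  }
                ; assoc = +-assoc′
                }
              ; identity = (λ _ → ≋-refl) , +-identityʳ′
              }
            ; inverse = (λ p → ≋-trans (+-comm′ (-ₚ p) p) (neg-inverseʳ′ p)) , neg-inverseʳ′
            ; ⁻¹-cong = neg-cong′
            }
          ; comm = +-comm′
          }
        ; *-cong = *-cong′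
        ; *-assoc = *-assoc′
        ; *-identity = *-identityˡ′ , λ p → ≋-trans (*-comm′ p (constant 1#)) (*-identityˡ′ p)
        ; distrib = *-distribˡ′ , *-distribʳ′
        }
      ; *-comm = *-comm′
      }

    polynomial-zero-product : ∀ {p r} → (p *ₚ r) ≋ [] → (p ≋ []) ⊎ (r ≋ [])
    polynomial-zero-product {p} {r} = zero-product′ p r

  polynomialRing : CommutativeRing c ℓ
  polynomialRing = record { isCommutativeRing = polynomial-isCommutativeRing }

  polynomialDomain : IntegralDomain c ℓ
  polynomialDomain = record
    { commutativeRing = polynomialRing
    ; _≟_             = ≋?
    ; 1≉0             = λ e → 1≉0 (coeff≈ e 0)
    ; zero-product    = polynomial-zero-product
    }

module Fractions {c ℓ : Level} (D : IntegralDomain c ℓ) where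

  open IntegralDomain D

  record Fraction : Set (c ⊔ ℓ) where
    constructor mkFraction
    field
      num   : Carrier
      den   : Carrier
      den≉0 : ¬ (den ≈ 0#)
  open Fraction public

  infix 4 _≃_
  record _≃_ (f g : Fraction) : Set ℓ where
    constructor mk≃
    field cross : num f * den g ≈ num g * den f
  open _≃_ public

  open SetoidReasoning setoid
  open Solver commutativeSemiring using (solve; _:=_; _:+_; _:*_)
  open RingProperties ring using (-‿distribˡ-*; x≈y⇒x∙y⁻¹≈ε; x∙y⁻¹≈ε⇒x≈y; [y-z]x≈yx-zx)

  cancel : ∀ {x y z} → ¬ (z ≈ 0#) → x * z ≈ y * z → x ≈ y
  cancel {x} {y} {z} z≉0 e with zero-product (trans ([y-z]x≈yx-zx z x y) (x≈y⇒x∙y⁻¹≈ε e))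
  ... | inj₁ x-y≈0 = x∙y⁻¹≈ε⇒x≈y x y x-y≈0
  ... | inj₂ z≈0   = contradiction z≈0 z≉0

  fromRing : Carrier → Fraction
  fromRing x = mkFraction x 1# 1≉0

  infixl 6 _+ᶠ_
  infixl 7 _*ᶠ_
  infix  8 -ᶠ_

  _+ᶠ_ : Fraction → Fraction → Fraction
  mkFraction n d d≉0 +ᶠ mkFraction m e e≉0 =
    mkFraction (n * e + m * d) (d * e) (*-nonzero d≉0 e≉0)

  -ᶠ_ : Fraction → Fraction
  -ᶠ mkFraction n d d≉0 = mkFraction (- n) d d≉0

  _*ᶠ_ : Fraction → Fraction → Fraction
  mkFraction n d d≉0 *ᶠ mkFraction m e e≉0 =
    mkFraction (n * m) (d * e) (*-nonzero d≉0 e≉0)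

  ≃-trans : ∀ {f g h} → f ≃ g → g ≃ h → f ≃ h
  ≃-trans {mkFraction n d _} {mkFraction m e e≉0} {mkFraction l k _} (mk≃ p) (mk≃ r) =
    mk≃ (cancel e≉0 (begin
      n * k * e   ≈⟨ solve 3 (λ n k e → n :* k :* e := n :* e :* k) refl n k e ⟩
      n * e * k   ≈⟨ *-congʳ p ⟩
      m * d * k   ≈⟨ solve 3 (λ m d k → m :* d :* k := m :* k :* d) refl m d k ⟩
      m * k * d   ≈⟨ *-congʳ r ⟩
      l * e * d   ≈⟨ solve 3 (λ l e d → l :* e :* d := l :* d :* e) refl l e d ⟩
      l * d * e   ∎))

  +-cong′ : ∀ {f f′ g g′} → f ≃ f′ → g ≃ g′ → (f +ᶠ g) ≃ (f′ +ᶠ g′)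
  +-cong′ {mkFraction n d _} {mkFraction n′ d′ _} {mkFraction m e _} {mkFraction m′ e′ _}
    (mk≃ p) (mk≃ r) = mk≃ (begin
      (n * e + m * d) * (d′ * e′)
        ≈⟨ solve 6 (λ n e m d d′ e′ → (n :* e :+ m :* d) :* (d′ :* e′)
             := (n :* d′) :* (e :* e′) :+ (m :* e′) :* (d :* d′)) refl n e m d d′ e′ ⟩
      (n * d′) * (e * e′) + (m * e′) * (d * d′)
        ≈⟨ +-cong (*-congʳ p) (*-congʳ r) ⟩
      (n′ * d) * (e * e′) + (m′ * e) * (d * d′)
        ≈⟨ solve 6 (λ n′ e m′ d d′ e′ → (n′ :* d) :* (e :* e′) :+ (m′ :* e) :* (d :* d′)
             := (n′ :* e′ :+ m′ :* d′) :* (d :* e)) refl n′ e m′ d d′ e′ ⟩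
      (n′ * e′ + m′ * d′) * (d * e) ∎)

  *-cong′ : ∀ {f f′ g g′} → f ≃ f′ → g ≃ g′ → (f *ᶠ g) ≃ (f′ *ᶠ g′)
  *-cong′ {mkFraction n d _} {mkFraction n′ d′ _} {mkFraction m e _} {mkFraction m′ e′ _}
    (mk≃ p) (mk≃ r) = mk≃ (begin
      (n * m) * (d′ * e′)
        ≈⟨ solve 4 (λ n m d′ e′ → (n :* m) :* (d′ :* e′) := (n :* d′) :* (m :* e′)) refl n m d′ e′ ⟩
      (n * d′) * (m * e′)
        ≈⟨ *-cong p r ⟩
      (n′ * d) * (m′ * e)
        ≈⟨ solve 4 (λ n m d′ e′ → (n :* d′) :* (m :* e′) := (n :* m) :* (d′ :* e′)) refl n′ m′ d e ⟩
      (n′ * m′) * (d * e) ∎)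

  assoc-eq : ∀ n d m e l k →
    ((n * e + m * d) * k + l * (d * e)) * (d * (e * k)) ≈
    (n * (e * k) + (m * k + l * e) * d) * ((d * e) * k)
  assoc-eq = solve 6 (λ n d m e l k →
    ((n :* e :+ m :* d) :* k :+ l :* (d :* e)) :* (d :* (e :* k)) :=
    (n :* (e :* k) :+ (m :* k :+ l :* e) :* d) :* ((d :* e) :* k)) refl

  *-assoc-eq : ∀ n d m e l k →
    ((n * m) * l) * (d * (e * k)) ≈ (n * (m * l)) * ((d * e) * k)
  *-assoc-eq = solve 6 (λ n d m e l k →
    ((n :* m) :* l) :* (d :* (e :* k)) := (n :* (m :* l)) :* ((d :* e) :* k)) refl

  comm-eq : ∀ n d m e → (n * e + m * d) * (e * d) ≈ (m * d + n * e) * (d * e)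
  comm-eq = solve 4 (λ n d m e →
    (n :* e :+ m :* d) :* (e :* d) := (m :* d :+ n :* e) :* (d :* e)) refl

  distribˡ-eq : ∀ n d m e l k →
    (n * (m * k + l * e)) * ((d * e) * (d * k)) ≈
    ((n * m) * (d * k) + (n * l) * (d * e)) * (d * (e * k))
  distribˡ-eq = solve 6 (λ n d m e l k →
    (n :* (m :* k :+ l :* e)) :* ((d :* e) :* (d :* k)) :=
    ((n :* m) :* (d :* k) :+ (n :* l) :* (d :* e)) :* (d :* (e :* k))) refl

  distribʳ-eq : ∀ n d m e l k →
    ((m * k + l * e) * n) * ((e * d) * (k * d)) ≈
    ((m * n) * (k * d) + (l * n) * (e * d)) * ((e * k) * d)
  distribʳ-eq = solve 6 (λ n d m e l k →
    ((m :* k :+ l :* e) :* n) :* ((e :* d) :* (k :* d)) :=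
    ((m :* n) :* (k :* d) :+ (l :* n) :* (e :* d)) :* ((e :* k) :* d)) refl

  idˡ : ∀ f → (0# * den f + num f * 1#) * den f ≈ num f * (1# * den f)
  idˡ f = *-cong (trans (+-cong (zeroˡ _) (*-identityʳ _)) (+-identityˡ _)) (sym (*-identityˡ _))

  idʳ : ∀ f → (num f * 1# + 0# * den f) * den f ≈ num f * (den f * 1#)
  idʳ f = *-cong (trans (+-cong (*-identityʳ _) (zeroˡ _)) (+-identityʳ _)) (sym (*-identityʳ _))

  zero-num : ∀ {x y} → x ≈ 0# → x * 1# ≈ 0# * y
  zero-num e = trans (*-identityʳ _) (trans e (sym (zeroˡ _)))

  invˡ : ∀ f → (- num f * den f + num f * den f) * 1# ≈ 0# * (den f * den f)
  invˡ f = zero-num (trans (+-congʳ (sym (-‿distribˡ-* _ _))) (-‿inverseˡ _))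

  invʳ : ∀ f → (num f * den f + - num f * den f) * 1# ≈ 0# * (den f * den f)
  invʳ f = zero-num (trans (+-congˡ (sym (-‿distribˡ-* _ _))) (-‿inverseʳ _))

  abstract
    fraction-isCommutativeRing : IsCommutativeRing _≃_ _+ᶠ_ _*ᶠ_ -ᶠ_ (fromRing 0#) (fromRing 1#)
    fraction-isCommutativeRing = record
      { isRing = record
        { +-isAbelianGroup = record
          { isGroup = record
            { isMonoid = record
              { isSemigroup = record
                { isMagma = record
                  { isEquivalence = record
                    { refl  = mk≃ refl
                    ; sym   = λ f≃g → mk≃ (sym (cross f≃g))
                    ; trans = λ {f} {g} {h} → ≃-trans {f} {g} {h}
                    }
                  ; ∙-cong = λ {f} {f′} {g} {g′} → +-cong′ {f} {f′} {g} {g′}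
                  }
                ; assoc = λ f g h → mk≃ (assoc-eq (num f) (den f) (num g) (den g) (num h) (den h))
                }
              ; identity = (λ f → mk≃ (idˡ f)) , (λ f → mk≃ (idʳ f))
              }
            ; inverse = (λ f → mk≃ (invˡ f)) , (λ f → mk≃ (invʳ f))
            ; ⁻¹-cong = λ {f} {g} f≃g → mk≃ (begin
                - num f * den g   ≈⟨ -‿distribˡ-* (num f) (den g) ⟨
                - (num f * den g) ≈⟨ -‿cong (cross f≃g) ⟩
                - (num g * den f) ≈⟨ -‿distribˡ-* (num g) (den f) ⟩
                - num g * den f   ∎)
            }
          ; comm = λ f g → mk≃ (comm-eq (num f) (den f) (num g) (den g))
          }
        ; *-cong = λ {f} {f′} {g} {g′} → *-cong′ {f} {f′} {g} {g′}
        ; *-assoc = λ f g h → mk≃ (*-assoc-eq (num f) (den f) (num g) (den g) (num h) (den h))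
        ; *-identity = (λ f → mk≃ (*-cong (*-identityˡ _) (sym (*-identityˡ _))))
                     , (λ f → mk≃ (*-cong (*-identityʳ _) (sym (*-identityʳ _))))
        ; distrib = (λ f g h → mk≃ (distribˡ-eq (num f) (den f) (num g) (den g) (num h) (den h)))
                  , (λ f g h → mk≃ (distribʳ-eq (num f) (den f) (num g) (den g) (num h) (den h)))
        }
      ; *-comm = λ f g → mk≃ (*-cong (*-comm _ _) (*-comm _ _))
      }

  fractionRing : CommutativeRing (c ⊔ ℓ) ℓ
  fractionRing = record { isCommutativeRing = fraction-isCommutativeRing }

  -- Total inverse with the convention 0⁻¹ = 0.
  infix 8 _⁻¹
  _⁻¹ : Fraction → Fraction
  mkFraction n d d≉0 ⁻¹ with n ≟ 0#
  ... | yes _   = fromRing 0#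
  ... | no  n≉0 = mkFraction d n n≉0

  ⁻¹-inverseʳ : ∀ f → ¬ (f ≃ fromRing 0#) → (f *ᶠ f ⁻¹) ≃ fromRing 1#
  ⁻¹-inverseʳ (mkFraction n d d≉0) f≄0 with n ≟ 0#
  ... | yes n≈0 = contradiction
                    (mk≃ (trans (*-identityʳ n) (trans n≈0 (sym (zeroˡ d))))) f≄0
  ... | no  n≉0 = mk≃ (begin
    (n * d) * 1#   ≈⟨ *-identityʳ _ ⟩
    n * d          ≈⟨ *-comm n d ⟩
    d * n          ≈⟨ *-identityˡ _ ⟨
    1# * (d * n)   ∎)

-- The q-calculus and congruences of the field of fractions of an integral
-- domain, the elements of the domain playing the role of polynomials.
module FractionField {c ℓ : Level} (R : IntegralDomain c ℓ) where

  open Fractions R public using (Fraction; mkFraction; fromRing; fractionRing; _⁻¹)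
  open CommutativeRing fractionRing public
    using (_≈_; _+_; _*_; _-_; -_; 0#; 1#; semiring)
  open RawSemiringDefinitions (Semiring.rawSemiring semiring) public using (_^_; sum)

  private
    module R = IntegralDomain R
    open RawSemiringDefinitions (Semiring.rawSemiring R.semiring) using (Coprime)

  infixl 7 _/_
  _/_ : Fraction → Fraction → Fraction
  f / g = f * g ⁻¹

  infixr 8 _^ℤ_
  _^ℤ_ : Fraction → ℤ → Fraction
  f ^ℤ (+ m)    = f ^ m
  f ^ℤ -[1+ m ] = (f ^ suc m) ⁻¹

  -- qShifted y b m is (y;b)_m.
  qShifted : Fraction → Fraction → ℕ → Fraction
  qShifted y b zero    = 1#
  qShifted y b (suc m) = qShifted y b m * (1# - y * b ^ m)

  -- qBinomial N k b is the q-binomial coefficient with q replaced by b.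
  qBinomial : ℕ → ℕ → Fraction → Fraction
  qBinomial N k b =
    if does (k ≤? N)
    then qShifted b b N / (qShifted b b k * qShifted b b (N ∸ k))
    else 0#

  infix 4 _≡_[mod_]
  _≡_[mod_] : Fraction → Fraction → R.Carrier → Set (c ⊔ ℓ)
  A ≡ B [mod P ] =
    Σ[ C ∈ R.Carrier ] Σ[ D ∈ R.Carrier ] Σ[ D≉0 ∈ (¬ (D R.≈ R.0#)) ]
      Coprime D P × (A - B) ≈ mkFraction (P R.* C) D D≉0

-- ℚ[a,q,x] is built as ((ℚ[q])[x])[a].
ℚ[q] ℚ[q,x] ℚ[a,q,x] : IntegralDomain 0ℓ 0ℓ
ℚ[q]     = Polynomials.polynomialDomain ℚ-integralDomain
ℚ[q,x]   = Polynomials.polynomialDomain ℚ[q]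
ℚ[a,q,x] = Polynomials.polynomialDomain ℚ[q,x]

module PolynomialIndeterminates where
  open IntegralDomain ℚ[a,q,x]
  open RawSemiringDefinitions (Semiring.rawSemiring semiring) using (_^_)

  aₚ qₚ xₚ : Carrier
  aₚ = Polynomials.X ℚ[q,x]
  xₚ = Polynomials.constant ℚ[q,x] (Polynomials.X ℚ[q])
  qₚ = Polynomials.constant ℚ[q,x] (Polynomials.constant ℚ[q] (Polynomials.X ℚ-integralDomain))

  modulus : ℕ → Carrier
  modulus n = (1# - aₚ * qₚ ^ n) * (aₚ - qₚ ^ n)

open PolynomialIndeterminates public using (aₚ; qₚ; xₚ; modulus)

module RationalFunctions where
  open FractionField ℚ[a,q,x] public

  a q x : Fraction
  a = fromRing aₚ
  q = fromRing qₚ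
  x = fromRing xₚ

{-# OPTIONS --safe #-}

-- Put b = q², n = 2m + 1 and P = (1 - aqⁿ)(a - qⁿ).  Since P/(aqⁿ) = qⁿ + q⁻ⁿ - a - 1/a,
-- the factors of the left-hand side satisfy
--   (1 - aq bⁱ)(1 - (q/a) bⁱ) = (1 - b^(m+1+i))(1 - b^(i-m)) + q bⁱ P/(aqⁿ),
-- so modulo P the left-hand side becomes Σ [m,k] [m+k,k] b^(k(k-1)/2-mk) (-x)ᵏ, free of a.
-- It equals the right-hand side: the two families of sums
--   Σ_k [m,r+k] [N+r+k,k] b^(k(k-1)/2-Nk) (-x)ᵏ  and
--   Σ_k [m,r+k] [N,k] b^(k(k-1)/2-Nk) (-x)ᵏ (x;b)_(m-r-k)
-- both satisfy F(N+1,r) = F(N,r) - x b^(-N-1) F(N,r+1), and at N = 0 they agree by the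
-- q-binomial theorem; the case r = 0, N = m is the claim.
-- All denominators are products of a, q and 1 - b^k.  Multiplication by P is injective
-- modulo each of these, a property which is inherited by products and which, in an
-- integral domain, implies coprimality with P.
module Submission where

open import Defs
open import Algebra.Bundles using (CommutativeRing; RawMonoid; RawSemiring; Semiring)
import Algebra.Definitions.RawMagma as RawMagmaDefinitions
import Algebra.Definitions.RawSemiring as RawSemiringDefinitions
import Algebra.Properties.CommutativeSemiring.Exp as CommutativeSemiringExp
import Algebra.Properties.Ring as RingProperties
import Algebra.Properties.Semiring.Exp as SemiringExp
import Algebra.Properties.Semiring.Mult.TCOptimised as SemiringMult
import Algebra.Properties.Semiring.Sum as SemiringSum
import Algebra.Solver.Ring as RingSolver
open import Algebra.Solver.Ring.AlmostCommutativeRing using (fromCommutativeRing; _-Raw-AlmostCommutative⟶_)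
open import Data.Bool.Base using (true)
open import Data.Fin.Base using (toℕ)
open import Data.Integer.Base as ℤ using (ℤ; +_; -[1+_])
import Data.Integer.Properties as ℤₚ
open import Data.List.Base using ([]; _∷_)
open import Data.Maybe.Base using (Maybe; just; nothing)
open import Data.Nat.Base as ℕ using (ℕ; zero; suc; _∸_; _<_; _≤_; z≤n; s≤s; z<s; s<s)
open import Data.Nat.DivMod using (m*n/n≡m)
import Data.Nat.Properties as ℕₚ
open import Data.Product.Base using (∃-syntax; _,_; proj₁; proj₂)
import Data.Sign.Base as Sign
open import Data.Sum.Base using (inj₁; inj₂)
open import Level using (Level; _⊔_) renaming (suc to lsuc)
import Relation.Binary.Reasoning.Setoid as SetoidReasoning
open import Relation.Binary.PropositionalEquality as ≡ using (_≡_)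
open import Relation.Nullary using (¬_; yes; no; contradiction)

-- Coprimality here says that every common divisor divides 1. To pass from factors to products with
-- that notion alone would take gcds or unique factorisation in ℚ[a,q,x]; injectivity of
-- multiplication passes to products by bare cancellation, so the denominators carry this property
-- until the very last step. In the claim the upper index of [m,k] and the number in the exponent
-- are the same m. No recurrence in m keeps the terms simple, because m also governs the products
-- (x;b)_(m-k). Hence the exponent and the second binomial get their own parameter N while m stays
-- fixed, and the induction can descend to N = 0. Since the reduction modulo P removes a altogether,
-- the remaining identity of sums is exact. It only uses that b and all (b;b)_k have inverses, and
-- is therefore proved over any commutative ring in which such inverses are given.

-- Ring identities with integer coefficients

module IntegerCoefficients {c ℓ : Level} (R : CommutativeRing c ℓ) where

  open CommutativeRing R hiding (zero)
  open RingProperties ring using (-0#≈0#; -‿involutive; -‿distribˡ-*; -‿distribʳ-*; -‿+-comm)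
  open SemiringMult semiring using (_×_; ×-homo-+; ×1-homo-*; 1+×)
  open SetoidReasoning setoid

  -- With this version of `_×_`, `con (+ 0)` and `con (+ 1)` evaluate to `0#` and `1#`
  -- definitionally, so solved identities fit goals that mention these constants.
  fromℤ : ℤ → Carrier
  fromℤ (+ n)    = n × 1#
  fromℤ -[1+ n ] = - (suc n × 1#)

  fromℤ-⊖ : ∀ m n → fromℤ (m ℤ.⊖ n) ≈ m × 1# - n × 1#
  fromℤ-⊖ m       zero    = sym (trans (+-congˡ -0#≈0#) (+-identityʳ _))
  fromℤ-⊖ zero    (suc n) = sym (+-identityˡ _)
  fromℤ-⊖ (suc m) (suc n) = begin
    fromℤ (suc m ℤ.⊖ suc n)                ≡⟨ ≡.cong fromℤ (ℤₚ.[1+m]⊖[1+n]≡m⊖n m n) ⟩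
    fromℤ (m ℤ.⊖ n)                        ≈⟨ fromℤ-⊖ m n ⟩
    -- Inserting `1# - 1#` supplies one more unit to each of the two multiples.
    m × 1# - n × 1#                        ≈⟨ +-congʳ (+-identityˡ _) ⟨
    0# + m × 1# - n × 1#                   ≈⟨ +-congʳ (+-congʳ (-‿inverseʳ 1#)) ⟨
    1# - 1# + m × 1# - n × 1#              ≈⟨ +-congʳ (trans (+-assoc _ _ _) (trans (+-congˡ (+-comm _ _)) (sym (+-assoc _ _ _)))) ⟩
    1# + m × 1# - 1# - n × 1#              ≈⟨ +-assoc _ _ _ ⟩
    1# + m × 1# + (- 1# - n × 1#)          ≈⟨ +-congˡ (-‿+-comm _ _) ⟩
    1# + m × 1# - (1# + n × 1#)            ≈⟨ +-cong (1+× m 1#) (-‿cong (1+× n 1#)) ⟨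
    suc m × 1# - suc n × 1#                ∎

  fromℤ-+ : ∀ i j → fromℤ (i ℤ.+ j) ≈ fromℤ i + fromℤ j
  fromℤ-+ (+ m)    (+ n)    = ×-homo-+ 1# m n
  fromℤ-+ (+ m)    -[1+ n ] = fromℤ-⊖ m (suc n)
  fromℤ-+ -[1+ m ] (+ n)    = trans (fromℤ-⊖ n (suc m)) (+-comm _ _)
  fromℤ-+ -[1+ m ] -[1+ n ] = trans (-‿cong (trans
    (reflexive (≡.cong (λ k → suc k × 1#) (≡.sym (ℕₚ.+-suc m n))))
    (×-homo-+ 1# (suc m) (suc n)))) (sym (-‿+-comm _ _))

  fromℤ-+◃ : ∀ n → fromℤ (Sign.+ ℤ.◃ n) ≈ n × 1#
  fromℤ-+◃ zero    = refl
  fromℤ-+◃ (suc n) = refl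

  fromℤ--◃ : ∀ n → fromℤ (Sign.- ℤ.◃ n) ≈ - (n × 1#)
  fromℤ--◃ zero    = sym -0#≈0#
  fromℤ--◃ (suc n) = refl

  fromℤ-* : ∀ i j → fromℤ (i ℤ.* j) ≈ fromℤ i * fromℤ j
  fromℤ-* (+ m)    (+ n)    = trans (fromℤ-+◃ (m ℕ.* n)) (×1-homo-* m n)
  fromℤ-* (+ m)    -[1+ n ] = trans (fromℤ--◃ (m ℕ.* suc n))
    (trans (-‿cong (×1-homo-* m (suc n))) (-‿distribʳ-* _ _))
  fromℤ-* -[1+ m ] (+ n)    = trans (fromℤ--◃ (suc m ℕ.* n))
    (trans (-‿cong (×1-homo-* (suc m) n)) (-‿distribˡ-* _ _))
  fromℤ-* -[1+ m ] -[1+ n ] = trans (fromℤ-+◃ (suc m ℕ.* suc n))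
    (trans (×1-homo-* (suc m) (suc n)) (trans (sym (-‿involutive _))
    (trans (-‿cong (-‿distribˡ-* _ _)) (-‿distribʳ-* _ _))))

  fromℤ-neg : ∀ i → fromℤ (ℤ.- i) ≈ - fromℤ i
  fromℤ-neg (+ zero)    = sym -0#≈0#
  fromℤ-neg (+ (suc n)) = refl
  fromℤ-neg -[1+ n ]    = sym (-‿involutive _)

  fromℤ-homomorphism : ℤ.+-*-rawRing -Raw-AlmostCommutative⟶ fromCommutativeRing R
  fromℤ-homomorphism = record
    { ⟦_⟧    = fromℤ
    ; +-homo = fromℤ-+
    ; *-homo = fromℤ-*
    ; -‿homo = fromℤ-neg
    ; 0-homo = refl
    ; 1-homo = refl
    }

  -- Only equality of the integers is tested. Different integers with equal images, as in positive
  -- characteristic, give `nothing`, which is sound.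
  fromℤ-≟ : ∀ i j → Maybe (fromℤ i ≈ fromℤ j)
  fromℤ-≟ i j with i ℤₚ.≟ j
  ... | yes i≡j = just (reflexive (≡.cong fromℤ i≡j))
  ... | no  _   = nothing

  open RingSolver ℤ.+-*-rawRing (fromCommutativeRing R) fromℤ-homomorphism fromℤ-≟ public
    using (solve; con; _:=_; _:+_; _:*_; _:-_; :-_)

-- Finite sums over initial segments of ℕ

module FiniteSums {c ℓ : Level} (R : CommutativeRing c ℓ) where

  open CommutativeRing R hiding (zero)
  open SemiringSum semiring using (sum; ∑-distrib-+; *-distribˡ-sum)

  -- Summands are functions on ℕ, so that an index shift is mere composition with `suc`; by
  -- definition this is the form of the sums in the theorem.
  ∑ : ℕ → (ℕ → Carrier) → Carrier
  ∑ n f = sum {n} (λ i → f (toℕ i))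

  ∑-cong : ∀ n {f g : ℕ → Carrier} → (∀ k → k < n → f k ≈ g k) → ∑ n f ≈ ∑ n g
  ∑-cong zero    e = refl
  ∑-cong (suc n) e = +-cong (e 0 z<s) (∑-cong n (λ k k<n → e (suc k) (s<s k<n)))

  ∑-zero : ∀ n (f : ℕ → Carrier) → (∀ k → f k ≈ 0#) → ∑ n f ≈ 0#
  ∑-zero zero    f e = refl
  ∑-zero (suc n) f e = trans (+-cong (e 0) (∑-zero n (λ k → f (suc k)) (λ k → e (suc k)))) (+-identityˡ 0#)

  -- The recurrence in `N` has this shape, and with `f` constantly zero it extracts a common factor.
  ∑-linear : ∀ n (f g : ℕ → Carrier) z → ∑ n (λ k → f k + z * g k) ≈ ∑ n f + z * ∑ n g
  ∑-linear n f g z = trans (∑-distrib-+ {n} (λ i → f (toℕ i)) (λ i → z * g (toℕ i)))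
    (+-congˡ (sym (*-distribˡ-sum {n} z (λ i → g (toℕ i)))))

  ∑-truncate : ∀ n j (f : ℕ → Carrier) → (∀ k → n ≤ k → f k ≈ 0#) → ∑ (n ℕ.+ j) f ≈ ∑ n f
  ∑-truncate zero    j f e = ∑-zero j f (λ k → e k z≤n)
  ∑-truncate (suc n) j f e = +-congˡ (∑-truncate n j (λ k → f (suc k)) (λ k n≤k → e (suc k) (s≤s n≤k)))

-- Cleared denominators and explicit inverses

module FractionArithmetic {c ℓ : Level} (K : CommutativeRing c ℓ) where

  open CommutativeRing K hiding (zero)
  open RawSemiringDefinitions (Semiring.rawSemiring semiring) using (_^_)
  open IntegerCoefficients K
  open SetoidReasoning setoid

  -- The relation `f * d ≈ e` expresses f = e/d without inverting `d`.
  add-fractions : ∀ {f g d d′ e e′} → f * d ≈ e → g * d′ ≈ e′ → (f + g) * (d * d′) ≈ e * d′ + e′ * d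
  add-fractions {f} {g} {d} {d′} {e} {e′} fd gd = begin
    (f + g) * (d * d′)            ≈⟨ solve 4 (λ f g d d′ → (f :+ g) :* (d :* d′) := f :* d :* d′ :+ g :* d′ :* d) refl f g d d′ ⟩
    f * d * d′ + g * d′ * d       ≈⟨ +-cong (*-congʳ fd) (*-congʳ gd) ⟩
    e * d′ + e′ * d               ∎

  multiply-fractions : ∀ {f g d d′ e e′} → f * d ≈ e → g * d′ ≈ e′ → f * g * (d * d′) ≈ e * e′
  multiply-fractions {f} {g} {d} {d′} {e} {e′} fd gd = begin
    f * g * (d * d′)              ≈⟨ solve 4 (λ f g d d′ → f :* g :* (d :* d′) := f :* d :* (g :* d′)) refl f g d d′ ⟩
    f * d * (g * d′)              ≈⟨ *-cong fd gd ⟩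
    e * e′                        ∎

  negate-fraction : ∀ {f d e} → f * d ≈ e → - f * d ≈ - e
  negate-fraction {f} {d} fd = trans (solve 2 (λ f d → :- f :* d := :- (f :* d)) refl f d) (-‿cong fd)

  inverse-unique : ∀ {f g h} → f * g ≈ 1# → f * h ≈ 1# → g ≈ h
  inverse-unique {f} {g} {h} fg fh = begin
    g              ≈⟨ *-identityʳ g ⟨
    g * 1#         ≈⟨ *-congˡ fh ⟨
    g * (f * h)    ≈⟨ solve 3 (λ f g h → g :* (f :* h) := f :* g :* h) refl f g h ⟩
    f * g * h      ≈⟨ *-congʳ fg ⟩
    1# * h         ≈⟨ *-identityˡ h ⟩
    h              ∎

  interchange : ∀ f g h k → f * g * (h * k) ≈ f * h * (g * k)
  interchange = solve 4 (λ f g h k → f :* g :* (h :* k) := f :* h :* (g :* k)) refl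

  power-inverse : ∀ {f g} → f * g ≈ 1# → ∀ n → f ^ n * g ^ n ≈ 1#
  power-inverse         fg zero    = *-identityˡ 1#
  power-inverse {f} {g} fg (suc n) = trans (interchange f (f ^ n) g (g ^ n))
    (trans (*-cong fg (power-inverse fg n)) (*-identityˡ 1#))

  -- The product `f * (f * 1#)` is the unfolding of `f ^ 2`.
  square-inverse : ∀ {f g} → f * g ≈ 1# → f * (f * 1#) * (g * g) ≈ 1#
  square-inverse {f} {g} fg = begin
    f * (f * 1#) * (g * g)    ≈⟨ solve 2 (λ f g → f :* (f :* con (+ 1)) :* (g :* g) := f :* g :* (f :* g)) refl f g ⟩
    f * g * (f * g)           ≈⟨ *-cong fg fg ⟩
    1# * 1#                   ≈⟨ *-identityˡ 1# ⟩
    1#                        ∎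

-- Gaussian binomials and the q-binomial theorem

module QSeries {c ℓ : Level} (R : CommutativeRing c ℓ) (b : CommutativeRing.Carrier R) where

  open CommutativeRing R hiding (zero)
  open RawSemiringDefinitions (Semiring.rawSemiring semiring) using (_^_)
  open SemiringExp semiring using (^-congˡ; ^-congʳ; ^-homo-*)
  open CommutativeSemiringExp commutativeSemiring using (^-distrib-*)
  open IntegerCoefficients R
  open FractionArithmetic R using (power-inverse)
  open FiniteSums R
  open SetoidReasoning setoid

  -- A version of `qShifted` over any commutative ring: it is used both among fractions and in the
  -- domain itself, where the denominators live.
  poch : Carrier → ℕ → Carrier
  poch y zero    = 1#
  poch y (suc m) = poch y m * (1# - y * b ^ m)

  -- The recursion of `poch` splits off the last factor, but the q-binomial theorem produces the
  -- first one.
  poch-shift : ∀ y d → poch y (suc d) ≈ (1# - y) * poch (y * b) d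
  poch-shift y zero    = solve 1 (λ y → con (+ 1) :* (con (+ 1) :- y :* con (+ 1)) := (con (+ 1) :- y) :* con (+ 1)) refl y
  poch-shift y (suc d) = begin
    poch y (suc d) * (1# - y * (b * b ^ d))
      ≈⟨ *-congʳ (poch-shift y d) ⟩
    (1# - y) * poch (y * b) d * (1# - y * (b * b ^ d))
      ≈⟨ solve 4 (λ y b p B → (con (+ 1) :- y) :* p :* (con (+ 1) :- y :* (b :* B))
           := (con (+ 1) :- y) :* (p :* (con (+ 1) :- y :* b :* B))) refl y b (poch (y * b) d) (b ^ d) ⟩
    (1# - y) * (poch (y * b) d * (1# - y * b * b ^ d)) ∎

  -- Pascal's rule as the definition avoids division and makes the coefficient vanish for `k > N`;
  -- `gauss-formula` connects it with factorials.
  gauss : ℕ → ℕ → Carrier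
  gauss _       zero    = 1#
  gauss zero    (suc k) = 0#
  gauss (suc N) (suc k) = gauss N k + b ^ suc k * gauss N (suc k)

  gauss-zero : ∀ {N k} → N < k → gauss N k ≈ 0#
  gauss-zero {zero}  {suc k} _ = refl
  gauss-zero {suc N} {suc k} (s≤s N<k) = trans
    (+-cong (gauss-zero N<k) (trans (*-congˡ (gauss-zero (ℕₚ.m<n⇒m<1+n N<k))) (zeroʳ _)))
    (+-identityˡ 0#)

  -- This is the ratio of neighbours, [N,k+1](1 - b^(k+1)) = [N,k](1 - b^(N-k)), multiplied by
  -- `b ^ k`: no difference of indices occurs, and `k > N` is included.
  gauss-next : ∀ N k → gauss N (suc k) * (1# - b ^ suc k) * b ^ k ≈ gauss N k * (b ^ k - b ^ N)
  gauss-next zero    zero    = solve 1 (λ b → con (+ 0) :* (con (+ 1) :- b) :* con (+ 1)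
    := con (+ 1) :* (con (+ 1) :- con (+ 1))) refl (b * 1#)
  gauss-next zero    (suc k) = trans (*-congʳ (zeroˡ _)) (trans (zeroˡ _) (sym (zeroˡ _)))
  gauss-next (suc N) zero    = begin
    (1# + b * 1# * g) * (1# - b * 1#) * 1#
      ≈⟨ solve 2 (λ b g → (con (+ 1) :+ b :* con (+ 1) :* g) :* (con (+ 1) :- b :* con (+ 1)) :* con (+ 1)
           := con (+ 1) :- b :+ b :* (g :* (con (+ 1) :- b :* con (+ 1)) :* con (+ 1))) refl b g ⟩
    1# - b + b * (g * (1# - b * 1#) * 1#)
      ≈⟨ +-congˡ (*-congˡ (gauss-next N zero)) ⟩
    1# - b + b * (1# * (1# - b ^ N))
      ≈⟨ solve 2 (λ b B → con (+ 1) :- b :+ b :* (con (+ 1) :* (con (+ 1) :- B))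
           := con (+ 1) :* (con (+ 1) :- b :* B)) refl b (b ^ N) ⟩
    1# * (1# - b * b ^ N) ∎
    where g = gauss N 1
  gauss-next (suc N) (suc k) = begin
    (g₁ + b * (b * B) * g₂) * (1# - b * (b * B)) * (b * B)
      ≈⟨ solve 4 (λ b B g₁ g₂ → (g₁ :+ b :* (b :* B) :* g₂) :* (con (+ 1) :- b :* (b :* B)) :* (b :* B)
           := g₁ :* (con (+ 1) :- b :* (b :* B)) :* (b :* B)
              :+ b :* (b :* B) :* (g₂ :* (con (+ 1) :- b :* (b :* B)) :* (b :* B))) refl b B g₁ g₂ ⟩
    g₁ * (1# - b * (b * B)) * (b * B) + b * (b * B) * (g₂ * (1# - b * (b * B)) * (b * B))
      -- The hypothesis at `suc k` removes `g₂`; the one at `k` then trades one occurrence of `g₁`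
      -- for `g₀`.
      ≈⟨ +-congˡ (*-congˡ (gauss-next N (suc k))) ⟩
    g₁ * (1# - b * (b * B)) * (b * B) + b * (b * B) * (g₁ * (b * B - b ^ N))
      ≈⟨ solve 4 (λ b B g₁ M → g₁ :* (con (+ 1) :- b :* (b :* B)) :* (b :* B) :+ b :* (b :* B) :* (g₁ :* (b :* B :- M))
           := b :* (g₁ :* (con (+ 1) :- b :* B) :* B) :+ b :* B :* g₁ :* (b :* B :- b :* M)) refl b B g₁ (b ^ N) ⟩
    b * (g₁ * (1# - b * B) * B) + b * B * g₁ * (b * B - b * b ^ N)
      ≈⟨ +-congʳ (*-congˡ (gauss-next N k)) ⟩
    b * (g₀ * (B - b ^ N)) + b * B * g₁ * (b * B - b * b ^ N)
      ≈⟨ solve 5 (λ b B g₀ g₁ M → b :* (g₀ :* (B :- M)) :+ b :* B :* g₁ :* (b :* B :- b :* M)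
           := (g₀ :+ b :* B :* g₁) :* (b :* B :- b :* M)) refl b B g₀ g₁ (b ^ N) ⟩
    (g₀ + b * B * g₁) * (b * B - b * b ^ N) ∎
    where
    B  = b ^ k
    g₀ = gauss N k
    g₁ = gauss N (suc k)
    g₂ = gauss N (suc (suc k))

  gauss-absorb : ∀ N k → gauss (suc N) (suc k) * (1# - b ^ suc k) ≈ gauss N k * (1# - b ^ suc N)
  gauss-absorb N k = begin
    (g₀ + b * B * g₁) * (1# - b * B)
      ≈⟨ solve 4 (λ b B g₀ g₁ → (g₀ :+ b :* B :* g₁) :* (con (+ 1) :- b :* B)
           := g₀ :* (con (+ 1) :- b :* B) :+ b :* (g₁ :* (con (+ 1) :- b :* B) :* B)) refl b B g₀ g₁ ⟩
    g₀ * (1# - b * B) + b * (g₁ * (1# - b * B) * B)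
      ≈⟨ +-congˡ (*-congˡ (gauss-next N k)) ⟩
    g₀ * (1# - b * B) + b * (g₀ * (B - b ^ N))
      ≈⟨ solve 4 (λ b B g₀ M → g₀ :* (con (+ 1) :- b :* B) :+ b :* (g₀ :* (B :- M))
           := g₀ :* (con (+ 1) :- b :* M)) refl b B g₀ (b ^ N) ⟩
    g₀ * (1# - b * b ^ N) ∎
    where
    B  = b ^ k
    g₀ = gauss N k
    g₁ = gauss N (suc k)

  fact : ℕ → Carrier
  fact = poch b

  gauss-fact : ∀ k j → gauss (k ℕ.+ j) k * (fact k * fact j) ≈ fact (k ℕ.+ j)
  gauss-fact zero    j = trans (*-identityˡ _) (*-identityˡ _)
  gauss-fact (suc k) j = begin
    g′ * (fact k * u * fact j)     ≈⟨ solve 4 (λ g f u h → g :* (f :* u :* h) := g :* u :* (f :* h)) refl g′ (fact k) u (fact j) ⟩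
    g′ * u * (fact k * fact j)     ≈⟨ *-congʳ (gauss-absorb (k ℕ.+ j) k) ⟩
    g * v * (fact k * fact j)      ≈⟨ solve 3 (λ g v h → g :* v :* h := g :* h :* v) refl g v (fact k * fact j) ⟩
    g * (fact k * fact j) * v      ≈⟨ *-congʳ (gauss-fact k j) ⟩
    fact (k ℕ.+ j) * v             ∎
    where
    g  = gauss (k ℕ.+ j) k
    g′ = gauss (suc k ℕ.+ j) (suc k)
    u  = 1# - b ^ suc k
    v  = 1# - b ^ suc (k ℕ.+ j)

  -- qtri k is b^(k(k-1)/2).
  qtri : ℕ → Carrier
  qtri zero    = 1#
  qtri (suc k) = b ^ k * qtri k

  -- Pascal's rule splits the sum into two sums for `d` at `x * b` whose lengths differ by one; the
  -- free bound `L` lets the induction hypothesis serve both. They combine with weight `1# - x`, the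
  -- first factor of the product.
  q-binomial-theorem : ∀ d L x → d < L → ∑ L (λ s → gauss d s * qtri s * (- x) ^ s) ≈ poch x d
  q-binomial-theorem zero    (suc L) x _         = trans (+-cong
    (trans (*-identityʳ _) (*-identityʳ _))
    (∑-zero L (λ s → gauss 0 (suc s) * qtri (suc s) * (- x) ^ suc s) (λ s → trans (*-congʳ (zeroˡ _)) (zeroˡ _)))) (+-identityʳ 1#)
  q-binomial-theorem (suc d) (suc L) x (s≤s d<L) = begin
    1# * 1# * 1# + ∑ L (λ s → gauss (suc d) (suc s) * qtri (suc s) * (- x) ^ suc s)
      ≈⟨ +-congˡ (∑-cong L (λ s _ → term s)) ⟩
    1# * 1# * 1# + ∑ L (λ s → f (suc s) + (- x) * f s)
      ≈⟨ +-congˡ (∑-linear L (λ s → f (suc s)) f (- x)) ⟩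
    f 0 + (∑ L (λ s → f (suc s)) + (- x) * ∑ L f)
      ≈⟨ +-assoc _ _ _ ⟨
    ∑ (suc L) f + (- x) * ∑ L f
      ≈⟨ +-cong (q-binomial-theorem d (suc L) (x * b) (ℕₚ.m<n⇒m<1+n d<L))
                (*-congˡ (q-binomial-theorem d L (x * b) d<L)) ⟩
    poch (x * b) d + (- x) * poch (x * b) d
      ≈⟨ solve 2 (λ x p → p :+ (:- x) :* p := (con (+ 1) :- x) :* p) refl x (poch (x * b) d) ⟩
    (1# - x) * poch (x * b) d
      ≈⟨ poch-shift x d ⟨
    poch x (suc d) ∎
    where
    f : ℕ → Carrier
    f s = gauss d s * qtri s * (- (x * b)) ^ s
    power : ∀ s → (- (x * b)) ^ s ≈ b ^ s * (- x) ^ s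
    power s = trans (^-congˡ s (solve 2 (λ x b → :- (x :* b) := b :* (:- x)) refl x b)) (^-distrib-* b (- x) s)
    term : ∀ s → gauss (suc d) (suc s) * qtri (suc s) * (- x) ^ suc s ≈ f (suc s) + (- x) * f s
    term s = begin
      (g₀ + b * B * g₁) * (B * qtri s) * (- x * Y)
        ≈⟨ solve 7 (λ b B g₀ g₁ t x Y → (g₀ :+ b :* B :* g₁) :* (B :* t) :* (x :* Y)
             := g₁ :* (B :* t) :* (b :* B :* (x :* Y)) :+ x :* (g₀ :* t :* (B :* Y)))
             refl b B g₀ g₁ (qtri s) (- x) Y ⟩
      g₁ * (B * qtri s) * (b * B * (- x * Y)) + - x * (g₀ * qtri s * (B * Y))
        ≈⟨ +-cong (*-congˡ (power (suc s))) (*-congˡ (*-congˡ (power s))) ⟨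
      f (suc s) + (- x) * f s ∎
      where
      B  = b ^ s
      Y  = (- x) ^ s
      g₀ = gauss d s
      g₁ = gauss d (suc s)

  module InvertibleFactorials
    (fact⁻¹ : ℕ → Carrier) (fact-inverse : ∀ k → fact k * fact⁻¹ k ≈ 1#) where

    cancel-fact : ∀ k {y z} → y * fact k ≈ z * fact k → y ≈ z
    cancel-fact k {y} {z} e = begin
      y                       ≈⟨ unit y ⟨
      y * fact k * fact⁻¹ k   ≈⟨ *-congʳ e ⟩
      z * fact k * fact⁻¹ k   ≈⟨ unit z ⟩
      z                       ∎
      where
      unit : ∀ u → u * fact k * fact⁻¹ k ≈ u
      unit u = trans (*-assoc _ _ _) (trans (*-congˡ (fact-inverse k)) (*-identityʳ u))

    gauss-formula : ∀ k j → gauss (k ℕ.+ j) k ≈ fact (k ℕ.+ j) * (fact⁻¹ k * fact⁻¹ j)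
    gauss-formula k j = cancel-fact k (cancel-fact j (begin
      g * fact k * fact j                       ≈⟨ *-assoc _ _ _ ⟩
      g * (fact k * fact j)                     ≈⟨ gauss-fact k j ⟩
      F                                         ≈⟨ trans (*-congˡ (*-identityˡ 1#)) (*-identityʳ F) ⟨
      F * (1# * 1#)                             ≈⟨ *-congˡ (*-cong (fact-inverse k) (fact-inverse j)) ⟨
      F * (fact k * fact⁻¹ k * (fact j * fact⁻¹ j))
        ≈⟨ solve 5 (λ F f u h v → F :* (f :* u :* (h :* v)) := F :* (u :* v) :* f :* h)
             refl F (fact k) (fact⁻¹ k) (fact j) (fact⁻¹ j) ⟩
      F * (fact⁻¹ k * fact⁻¹ j) * fact k * fact j ∎))
      where
      g = gauss (k ℕ.+ j) k
      F = fact (k ℕ.+ j)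

    -- Both sides are the trinomial coefficient: multiplied by (b;b)_r (b;b)_s (b;b)_t they become
    -- (b;b)_(r+s+t).
    gauss-revision : ∀ r s t → gauss (r ℕ.+ (s ℕ.+ t)) (r ℕ.+ s) * gauss (r ℕ.+ s) s
      ≈ gauss (r ℕ.+ (s ℕ.+ t)) r * gauss (s ℕ.+ t) s
    gauss-revision r s t = cancel-fact r (cancel-fact s (cancel-fact t (begin
      g₁ * g₂ * fact r * fact s * fact t
        ≈⟨ solve 5 (λ g h x y z → g :* h :* x :* y :* z := g :* (h :* (y :* x) :* z)) refl g₁ g₂ (fact r) (fact s) (fact t) ⟩
      g₁ * (g₂ * (fact s * fact r) * fact t)
        ≈⟨ *-congˡ (*-congʳ rs) ⟩
      g₁ * (fact (r ℕ.+ s) * fact t)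
        ≈⟨ rst ⟩
      fact (r ℕ.+ (s ℕ.+ t))
        ≈⟨ gauss-fact r (s ℕ.+ t) ⟨
      g₃ * (fact r * fact (s ℕ.+ t))
        ≈⟨ *-congˡ (*-congˡ (gauss-fact s t)) ⟨
      g₃ * (fact r * (g₄ * (fact s * fact t)))
        ≈⟨ solve 5 (λ g h x y z → g :* (x :* (h :* (y :* z))) := g :* h :* x :* y :* z) refl g₃ g₄ (fact r) (fact s) (fact t) ⟩
      g₃ * g₄ * fact r * fact s * fact t ∎)))
      where
      g₁ = gauss (r ℕ.+ (s ℕ.+ t)) (r ℕ.+ s)
      g₂ = gauss (r ℕ.+ s) s
      g₃ = gauss (r ℕ.+ (s ℕ.+ t)) r
      g₄ = gauss (s ℕ.+ t) s
      rs : g₂ * (fact s * fact r) ≈ fact (r ℕ.+ s)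
      rs rewrite ℕₚ.+-comm r s = gauss-fact s r
      rst : g₁ * (fact (r ℕ.+ s) * fact t) ≈ fact (r ℕ.+ (s ℕ.+ t))
      rst rewrite ≡.sym (ℕₚ.+-assoc r s t) = gauss-fact (r ℕ.+ s) t

    -- The transformation of weighted sums

    module InvertibleBase (w : Carrier) (bw≈1 : b * w ≈ 1#) where

      -- weight N k is b^(k(k-1)/2 - Nk).
      weight : ℕ → ℕ → Carrier
      weight N k = qtri k * w ^ (N ℕ.* k)

      weight-lower : ∀ N k → b ^ k * weight (suc N) k ≈ weight N k
      weight-lower N k = begin
        b ^ k * (qtri k * w ^ (k ℕ.+ N ℕ.* k))           ≈⟨ *-congˡ (*-congˡ (^-homo-* w k (N ℕ.* k))) ⟩
        b ^ k * (qtri k * (w ^ k * w ^ (N ℕ.* k)))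
          ≈⟨ solve 4 (λ B t W V → B :* (t :* (W :* V)) := B :* W :* (t :* V)) refl (b ^ k) (qtri k) (w ^ k) (w ^ (N ℕ.* k)) ⟩
        b ^ k * w ^ k * (qtri k * w ^ (N ℕ.* k))         ≈⟨ *-congʳ (power-inverse bw≈1 k) ⟩
        1# * (qtri k * w ^ (N ℕ.* k))                    ≈⟨ *-identityˡ _ ⟩
        weight N k                                       ∎

      weight-next : ∀ N k → weight N (suc k) ≈ b ^ k * w ^ N * weight N k
      weight-next N k = begin
        b ^ k * qtri k * w ^ (N ℕ.* suc k)               ≈⟨ *-congˡ (^-congʳ w (ℕₚ.*-suc N k)) ⟩
        b ^ k * qtri k * w ^ (N ℕ.+ N ℕ.* k)             ≈⟨ *-congˡ (^-homo-* w N (N ℕ.* k)) ⟩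
        b ^ k * qtri k * (w ^ N * w ^ (N ℕ.* k))
          ≈⟨ solve 4 (λ B t W V → B :* t :* (W :* V) := B :* W :* (t :* V)) refl (b ^ k) (qtri k) (w ^ N) (w ^ (N ℕ.* k)) ⟩
        b ^ k * w ^ N * (qtri k * w ^ (N ℕ.* k))         ∎

      weight-shift : ∀ N k → weight (suc N) (suc k) ≈ w ^ suc N * weight N k
      weight-shift N k = begin
        weight (suc N) (suc k)                        ≈⟨ weight-next (suc N) k ⟩
        b ^ k * w ^ suc N * weight (suc N) k          ≈⟨ solve 3 (λ B W e → B :* W :* e := W :* (B :* e)) refl (b ^ k) (w ^ suc N) (weight (suc N) k) ⟩
        w ^ suc N * (b ^ k * weight (suc N) k)        ≈⟨ *-congˡ (weight-lower N k) ⟩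
        w ^ suc N * weight N k                        ∎

      -- Pascal's factor `b ^ suc k` is exactly what lowers the weight from `suc N` to `N`. The
      -- index `M` is independent of `N` because the left family takes M = N + r + k + 1 and the
      -- right family M = N.
      weighted-pascal : ∀ M N k → gauss (suc M) (suc k) * weight (suc N) (suc k)
        ≈ gauss M (suc k) * weight N (suc k) + w ^ suc N * (gauss M k * weight N k)
      weighted-pascal M N k = begin
        (g₀ + b ^ suc k * g₁) * E
          ≈⟨ solve 4 (λ g₀ B g₁ E → (g₀ :+ B :* g₁) :* E := g₁ :* (B :* E) :+ g₀ :* E) refl g₀ (b ^ suc k) g₁ E ⟩
        g₁ * (b ^ suc k * E) + g₀ * E
          ≈⟨ +-cong (*-congˡ (weight-lower N (suc k))) (*-congˡ (weight-shift N k)) ⟩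
        g₁ * weight N (suc k) + g₀ * (w ^ suc N * weight N k)
          ≈⟨ +-congˡ (solve 3 (λ g W e → g :* (W :* e) := W :* (g :* e)) refl g₀ (w ^ suc N) (weight N k)) ⟩
        g₁ * weight N (suc k) + w ^ suc N * (g₀ * weight N k) ∎
        where
        g₀ = gauss M k
        g₁ = gauss M (suc k)
        E  = weight (suc N) (suc k)

      module Transformation (m : ℕ) (x : Carrier) where

        -- One of Pascal's two terms lowers `k`, while the lower index of [m,r+k] must not move;
        -- raising `r` compensates.
        lhsTerm rhsTerm : ℕ → ℕ → ℕ → Carrier
        lhsTerm N r k = gauss m (r ℕ.+ k) * (gauss (N ℕ.+ (r ℕ.+ k)) k * weight N k) * (- x) ^ k
        rhsTerm N r k = gauss m (r ℕ.+ k) * (gauss N k * weight N k) * (- x) ^ k * poch x (m ∸ (r ℕ.+ k))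

        lhsTerm-pascal : ∀ N r k → lhsTerm (suc N) r (suc k) ≈ lhsTerm N r (suc k) + - x * w ^ suc N * lhsTerm N (suc r) k
        lhsTerm-pascal N r k rewrite ℕₚ.+-suc r k = begin
          A * (gauss (suc M) (suc k) * weight (suc N) (suc k)) * (- x * Y)
            ≈⟨ *-congʳ (*-congˡ (weighted-pascal M N k)) ⟩
          A * (G₁ + w ^ suc N * G₀) * (- x * Y)
            ≈⟨ solve 6 (λ A G₁ W G₀ x Y → A :* (G₁ :+ W :* G₀) :* (x :* Y)
                 := A :* G₁ :* (x :* Y) :+ x :* W :* (A :* G₀ :* Y)) refl A G₁ (w ^ suc N) G₀ (- x) Y ⟩
          A * G₁ * (- x * Y) + - x * w ^ suc N * (A * G₀ * Y) ∎
          where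
          M  = N ℕ.+ suc (r ℕ.+ k)
          A  = gauss m (suc (r ℕ.+ k))
          Y  = (- x) ^ k
          G₀ = gauss M k * weight N k
          G₁ = gauss M (suc k) * weight N (suc k)

        rhsTerm-pascal : ∀ N r k → rhsTerm (suc N) r (suc k) ≈ rhsTerm N r (suc k) + - x * w ^ suc N * rhsTerm N (suc r) k
        rhsTerm-pascal N r k rewrite ℕₚ.+-suc r k = begin
          A * (gauss (suc N) (suc k) * weight (suc N) (suc k)) * (- x * Y) * P
            ≈⟨ *-congʳ (*-congʳ (*-congˡ (weighted-pascal N N k))) ⟩
          A * (G₁ + w ^ suc N * G₀) * (- x * Y) * P
            ≈⟨ solve 7 (λ A G₁ W G₀ x Y P → A :* (G₁ :+ W :* G₀) :* (x :* Y) :* P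
                 := A :* G₁ :* (x :* Y) :* P :+ x :* W :* (A :* G₀ :* Y :* P)) refl A G₁ (w ^ suc N) G₀ (- x) Y P ⟩
          A * G₁ * (- x * Y) * P + - x * w ^ suc N * (A * G₀ * Y * P) ∎
          where
          A  = gauss m (suc (r ℕ.+ k))
          Y  = (- x) ^ k
          P  = poch x (m ∸ suc (r ℕ.+ k))
          G₀ = gauss N k * weight N k
          G₁ = gauss N (suc k) * weight N (suc k)

        -- The term at 0 has no Pascal splitting and must be the same for `N` and `suc N`. The
        -- second sum is shorter by one, so `r` plus the length is preserved.
        ∑-pascal : (f : ℕ → ℕ → ℕ → Carrier) →
          (∀ N r → f (suc N) r 0 ≈ f N r 0) →
          (∀ N r k → f (suc N) r (suc k) ≈ f N r (suc k) + - x * w ^ suc N * f N (suc r) k) →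
          ∀ N r L → ∑ (suc L) (f (suc N) r) ≈ ∑ (suc L) (f N r) + - x * w ^ suc N * ∑ L (f N (suc r))
        ∑-pascal f f₀ f₊ N r L = begin
          f (suc N) r 0 + ∑ L (λ k → f (suc N) r (suc k))
            ≈⟨ +-cong (f₀ N r) (∑-cong L (λ k _ → f₊ N r k)) ⟩
          f N r 0 + ∑ L (λ k → f N r (suc k) + - x * w ^ suc N * f N (suc r) k)
            ≈⟨ +-congˡ (∑-linear L (λ k → f N r (suc k)) (f N (suc r)) (- x * w ^ suc N)) ⟩
          f N r 0 + (∑ L (λ k → f N r (suc k)) + - x * w ^ suc N * ∑ L (f N (suc r)))
            ≈⟨ +-assoc _ _ _ ⟨
          ∑ (suc L) (f N r) + - x * w ^ suc N * ∑ L (f N (suc r)) ∎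

        -- Trinomial revision takes [m,r] out of the sum and leaves the q-binomial theorem for d = m
        -- - r.
        base-lhs : ∀ r d → r ℕ.+ d ≡ m → ∑ (suc d) (lhsTerm 0 r) ≈ gauss m r * poch x d
        base-lhs r d ≡.refl = begin
          ∑ (suc d) (lhsTerm 0 r)
            ≈⟨ ∑-cong (suc d) term ⟩
          -- The summand `0#` brings the term into the form required by `∑-linear`.
          ∑ (suc d) (λ s → 0# + gauss m r * f s)
            ≈⟨ ∑-linear (suc d) (λ _ → 0#) f (gauss m r) ⟩
          ∑ (suc d) (λ _ → 0#) + gauss m r * ∑ (suc d) f
            ≈⟨ +-cong (∑-zero (suc d) (λ _ → 0#) (λ _ → refl)) (*-congˡ (q-binomial-theorem d (suc d) x ℕₚ.≤-refl)) ⟩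
          0# + gauss m r * poch x d
            ≈⟨ +-identityˡ _ ⟩
          gauss m r * poch x d ∎
          where
          f : ℕ → Carrier
          f s = gauss d s * qtri s * (- x) ^ s
          revision : ∀ s → s ≤ d → gauss m (r ℕ.+ s) * gauss (r ℕ.+ s) s ≈ gauss m r * gauss d s
          revision s s≤d with ℕₚ.m≤n⇒∃[o]m+o≡n s≤d
          ... | t , ≡.refl = gauss-revision r s t
          term : ∀ s → s < suc d → lhsTerm 0 r s ≈ 0# + gauss m r * f s
          term s (s≤s s≤d) = begin
            A * (B * (qtri s * 1#)) * Y
              ≈⟨ solve 4 (λ A B t Y → A :* (B :* (t :* con (+ 1))) :* Y := A :* B :* (t :* Y)) refl A B (qtri s) Y ⟩
            A * B * (qtri s * Y)
              ≈⟨ *-congʳ (revision s s≤d) ⟩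
            gauss m r * gauss d s * (qtri s * Y)
              ≈⟨ solve 4 (λ A B t Y → A :* B :* (t :* Y) := con (+ 0) :+ A :* (B :* t :* Y)) refl (gauss m r) (gauss d s) (qtri s) Y ⟩
            0# + gauss m r * f s ∎
            where
            A = gauss m (r ℕ.+ s)
            B = gauss (r ℕ.+ s) s
            Y = (- x) ^ s

        -- Only the term at 0 survives, because [0,k] vanishes for positive k.
        base-rhs : ∀ r d → r ℕ.+ d ≡ m → ∑ (suc d) (rhsTerm 0 r) ≈ gauss m r * poch x d
        base-rhs r d ≡.refl = trans
          (+-cong first (∑-zero d (λ k → rhsTerm 0 r (suc k)) rest))
          (+-identityʳ _)
          where
          rest : ∀ k → rhsTerm 0 r (suc k) ≈ 0#
          rest k = trans (*-congʳ (trans (*-congʳ (trans (*-congˡ (zeroˡ _)) (zeroʳ _))) (zeroˡ _))) (zeroˡ _)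
          first : rhsTerm 0 r 0 ≈ gauss m r * poch x d
          first rewrite ℕₚ.+-identityʳ r | ℕₚ.m+n∸m≡n r d =
            solve 2 (λ g p → g :* (con (+ 1) :* (con (+ 1) :* con (+ 1))) :* con (+ 1) :* p := g :* p) refl (gauss m r) (poch x d)

        -- The condition lets k run exactly through 0, ..., m - r. The recurrence leads from (r,
        -- L+1) to itself and to (r+1, L), which also satisfy it, so no boundary terms arise.
        transformation : ∀ N r L → r ℕ.+ L ≡ suc m → ∑ L (lhsTerm N r) ≈ ∑ L (rhsTerm N r)
        transformation N       r zero    _ = refl
        transformation zero    r (suc d) e = trans (base-lhs r d r+d≡m) (sym (base-rhs r d r+d≡m))
          where
          r+d≡m : r ℕ.+ d ≡ m
          r+d≡m = ℕₚ.suc-injective (≡.trans (≡.sym (ℕₚ.+-suc r d)) e)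
        transformation (suc N) r (suc L) e = begin
          ∑ (suc L) (lhsTerm (suc N) r)
            ≈⟨ ∑-pascal lhsTerm (λ _ _ → refl) lhsTerm-pascal N r L ⟩
          ∑ (suc L) (lhsTerm N r) + - x * w ^ suc N * ∑ L (lhsTerm N (suc r))
            ≈⟨ +-cong (transformation N r (suc L) e)
                 (*-congˡ (transformation N (suc r) L (≡.trans (≡.sym (ℕₚ.+-suc r L)) e))) ⟩
          ∑ (suc L) (rhsTerm N r) + - x * w ^ suc N * ∑ L (rhsTerm N (suc r))
            ≈⟨ ∑-pascal rhsTerm (λ _ _ → refl) rhsTerm-pascal N r L ⟨
          ∑ (suc L) (rhsTerm (suc N) r) ∎

        -- (b^(m+1);b)_k (b^(-m);b)_k
        specialised : ℕ → Carrier
        specialised zero    = 1#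
        specialised (suc k) = specialised k * ((1# - b ^ suc (m ℕ.+ k)) * (1# - b ^ k * w ^ m))

        -- In the induction `gauss-absorb` accounts for the factor 1 - b^(m+k+1) and `gauss-next`
        -- for 1 - b^(k-m); each consumes one of the two new factors 1 - b^(k+1).
        specialised-lhsTerm : ∀ k → specialised k * x ^ k ≈ lhsTerm m 0 k * (fact k * fact k)
        specialised-lhsTerm zero    = begin
          1# * 1#
            ≈⟨ solve 0 (con (+ 1) :* con (+ 1) := con (+ 1) :* (con (+ 1) :* (con (+ 1) :* con (+ 1))) :* con (+ 1) :* (con (+ 1) :* con (+ 1))) refl ⟩
          1# * (1# * (1# * 1#)) * 1# * (1# * 1#)
            ≈⟨ *-congʳ (*-congʳ (*-congˡ (*-congˡ (*-congˡ (^-congʳ w (ℕₚ.*-zeroʳ m)))))) ⟨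
          lhsTerm m 0 0 * (1# * 1#) ∎
        specialised-lhsTerm (suc k) rewrite ℕₚ.+-suc m k = begin
          S * (u * (1# - B * W)) * (x * x ^ k)
            ≈⟨ solve 5 (λ S u v x X → S :* (u :* v) :* (x :* X) := S :* X :* (x :* (u :* v))) refl S u (1# - B * W) x (x ^ k) ⟩
          S * x ^ k * (x * (u * (1# - B * W)))
            ≈⟨ *-congʳ (specialised-lhsTerm k) ⟩
          g * (h * e) * Y * (F * F) * (x * (u * (1# - B * W)))
            -- Writing `1#` as `b ^ m * w ^ m` turns 1 - b^(k-m) into -(b^k - b^m) b^(-m); the sign
            -- moves to `x`.
            ≈⟨ *-congˡ (*-congˡ (*-congˡ (+-congʳ (power-inverse bw≈1 m)))) ⟨
          g * (h * e) * Y * (F * F) * (x * (u * (b ^ m * W - B * W)))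
            ≈⟨ solve 10 (λ g h e Y F x u M B W → g :* (h :* e) :* Y :* (F :* F) :* (x :* (u :* (M :* W :- B :* W)))
                 := g :* (B :- M) :* (h :* u) :* (W :* e :* ((:- x) :* Y) :* (F :* F))) refl g h e Y F x u (b ^ m) B W ⟩
          g * (B - b ^ m) * (h * u) * (W * e * (- x * Y) * (F * F))
            ≈⟨ *-congʳ (*-cong (gauss-next m k) (gauss-absorb (m ℕ.+ k) k)) ⟨
          g′ * v * B * (h′ * v) * (W * e * (- x * Y) * (F * F))
            ≈⟨ solve 9 (λ g h e z Y F v B W → g :* v :* B :* (h :* v) :* (W :* e :* (z :* Y) :* (F :* F))
                 := g :* (h :* (B :* W :* e)) :* (z :* Y) :* (F :* v :* (F :* v))) refl g′ h′ e (- x) Y F v B W ⟩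
          g′ * (h′ * (B * W * e)) * (- x * Y) * (F * v * (F * v))
            ≈⟨ *-congʳ (*-congʳ (*-congˡ (*-congˡ (weight-next m k)))) ⟨
          g′ * (h′ * weight m (suc k)) * (- x * Y) * (F * v * (F * v)) ∎
          where
          S  = specialised k
          u  = 1# - b ^ suc (m ℕ.+ k)
          v  = 1# - b ^ suc k
          B  = b ^ k
          W  = w ^ m
          g  = gauss m k
          h  = gauss (m ℕ.+ k) k
          g′ = gauss m (suc k)
          h′ = gauss (suc (m ℕ.+ k)) (suc k)
          e  = weight m k
          Y  = (- x) ^ k
          F  = fact k

        -- Up to a rescaling of `x` the left side is a little q-Legendre polynomial in base `b`. Its
        -- terms beyond k = m vanish with [m,k].
        specialised-identity :
          ∑ (suc m ℕ.+ m) (λ k → specialised k * (fact⁻¹ k * fact⁻¹ k) * x ^ k) ≈ ∑ (suc m) (rhsTerm m 0)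
        specialised-identity = begin
          ∑ (suc m ℕ.+ m) (λ k → specialised k * (fact⁻¹ k * fact⁻¹ k) * x ^ k)
            ≈⟨ ∑-cong (suc m ℕ.+ m) (λ k _ → term k) ⟩
          ∑ (suc m ℕ.+ m) (lhsTerm m 0)
            ≈⟨ ∑-truncate (suc m) m (lhsTerm m 0) (λ k m<k →
                 trans (*-congʳ (trans (*-congʳ (gauss-zero m<k)) (zeroˡ _))) (zeroˡ _)) ⟩
          ∑ (suc m) (lhsTerm m 0)
            ≈⟨ transformation m 0 (suc m) ≡.refl ⟩
          ∑ (suc m) (rhsTerm m 0) ∎
          where
          term : ∀ k → specialised k * (fact⁻¹ k * fact⁻¹ k) * x ^ k ≈ lhsTerm m 0 k
          term k = begin
            specialised k * (fact⁻¹ k * fact⁻¹ k) * x ^ k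
              ≈⟨ solve 3 (λ s i X → s :* (i :* i) :* X := s :* X :* (i :* i)) refl (specialised k) (fact⁻¹ k) (x ^ k) ⟩
            specialised k * x ^ k * (fact⁻¹ k * fact⁻¹ k)
              ≈⟨ *-congʳ (specialised-lhsTerm k) ⟩
            lhsTerm m 0 k * (fact k * fact k) * (fact⁻¹ k * fact⁻¹ k)
              ≈⟨ solve 3 (λ t f i → t :* (f :* f) :* (i :* i) := t :* (f :* i :* (f :* i))) refl (lhsTerm m 0 k) (fact k) (fact⁻¹ k) ⟩
            lhsTerm m 0 k * (fact k * fact⁻¹ k * (fact k * fact⁻¹ k))
              ≈⟨ *-congˡ (*-cong (fact-inverse k) (fact-inverse k)) ⟩
            lhsTerm m 0 k * (1# * 1#)
              ≈⟨ trans (*-congˡ (*-identityˡ 1#)) (*-identityʳ _) ⟩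
            lhsTerm m 0 k ∎

-- Transversality in an integral domain

module Transversality {c ℓ : Level} (R : IntegralDomain c ℓ) where

  open IntegralDomain R hiding (zero)
  open Fractions R using (cancel)
  open RawSemiringDefinitions (Semiring.rawSemiring semiring) public using (_^_; _∣_; Coprime)
  open RawMagmaDefinitions (RawMonoid.rawMagma (RawSemiring.*-rawMonoid (Semiring.rawSemiring semiring))) public using (_,_)
  open IntegerCoefficients commutativeRing
  open SetoidReasoning setoid

  -- Multiplication by y is injective modulo d.
  infix 4 _⟂_
  record _⟂_ (d y : Carrier) : Set (c ⊔ ℓ) where
    field cancels : ∀ g → d ∣ y * g → d ∣ g
  open _⟂_ public

  ⟂-respˡ : ∀ {d d′ y} → d ≈ d′ → d ⟂ y → d′ ⟂ y
  cancels (⟂-respˡ d≈d′ d⟂y) g (f , e) with cancels d⟂y g (f , trans (*-congˡ d≈d′) e)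
  ... | h , e′ = h , trans (*-congˡ (sym d≈d′)) e′

  ⟂-respʳ : ∀ {d y y′} → y ≈ y′ → d ⟂ y → d ⟂ y′
  cancels (⟂-respʳ y≈y′ d⟂y) g (f , e) = cancels d⟂y g (f , trans e (*-congʳ (sym y≈y′)))

  1⟂ : ∀ y → 1# ⟂ y
  cancels (1⟂ y) g _ = g , *-identityʳ g

  ⟂1 : ∀ d → d ⟂ 1#
  cancels (⟂1 d) g (f , e) = f , trans e (*-identityˡ g)

  -- If `d * d′` divides `y * g`, then so does `d`, hence g = h d; cancelling `d` shows that `d′`
  -- divides `y * h`, hence `h`.
  ⟂-*ˡ : ∀ {d d′ y} → ¬ (d ≈ 0#) → d ⟂ y → d′ ⟂ y → d * d′ ⟂ y
  cancels (⟂-*ˡ {d} {d′} {y} d≉0 d⟂y d′⟂y) g (f , e)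
    with cancels d⟂y g (f * d′ , trans (solve 3 (λ f d d′ → f :* d′ :* d := f :* (d :* d′)) refl f d d′) e)
  ... | h , hd≈g
    with cancels d′⟂y h (f , cancel d≉0 (begin
      f * d′ * d     ≈⟨ solve 3 (λ f d d′ → f :* d′ :* d := f :* (d :* d′)) refl f d d′ ⟩
      f * (d * d′)   ≈⟨ e ⟩
      y * g          ≈⟨ *-congˡ hd≈g ⟨
      y * (h * d)    ≈⟨ *-assoc _ _ _ ⟨
      y * h * d      ∎))
  ... | k , kd′≈h = k , (begin
      k * (d * d′)   ≈⟨ solve 3 (λ k d d′ → k :* (d :* d′) := k :* d′ :* d) refl k d d′ ⟩
      k * d′ * d     ≈⟨ *-congʳ kd′≈h ⟩
      h * d          ≈⟨ hd≈g ⟩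
      g              ∎)

  ⟂-*ʳ : ∀ {d y z} → d ⟂ y → d ⟂ z → d ⟂ y * z
  cancels (⟂-*ʳ {z = z} d⟂y d⟂z) g (f , e) = cancels d⟂z g (cancels d⟂y (z * g) (f , trans e (*-assoc _ _ _)))

  ⟂-^ : ∀ {d y} n → d ⟂ y → d ⟂ y ^ n
  ⟂-^ {d} zero    d⟂y = ⟂1 d
  ⟂-^     (suc n) d⟂y = ⟂-*ʳ d⟂y (⟂-^ n d⟂y)

  ⟂-neg : ∀ {d y} → d ⟂ y → d ⟂ - y
  cancels (⟂-neg {d} {y} d⟂y) g (f , e) = cancels d⟂y g (- f , (begin
    - f * d        ≈⟨ solve 2 (λ f d → :- f :* d := :- (f :* d)) refl f d ⟩
    - (f * d)      ≈⟨ -‿cong e ⟩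
    - (- y * g)    ≈⟨ solve 2 (λ y g → :- (:- y :* g) := y :* g) refl y g ⟩
    y * g          ∎))

  -- Only the residue of `y` modulo `d` matters, so P may be replaced by a simple representative for
  -- each denominator.
  ⟂-shift : ∀ {d y} z → d ⟂ y → d ⟂ y + d * z
  cancels (⟂-shift {d} {y} z d⟂y) g (f , e) = cancels d⟂y g (f - z * g , (begin
    (f - z * g) * d              ≈⟨ solve 4 (λ f z g d → (f :- z :* g) :* d := f :* d :- d :* z :* g) refl f z g d ⟩
    f * d - d * z * g            ≈⟨ +-congʳ e ⟩
    (y + d * z) * g - d * z * g  ≈⟨ solve 4 (λ y d z g → (y :+ d :* z) :* g :- d :* z :* g := y :* g) refl y d z g ⟩
    y * g                        ∎))

  -- Modulo `1# - y * z` the inverse of `y` is `z`; the witness comes from g = (1 - yz) g + z (yg).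
  1-yz⟂y : ∀ y z → 1# - y * z ⟂ y
  cancels (1-yz⟂y y z) g (f , e) = g + z * f , (begin
    (g + z * f) * (1# - y * z)             ≈⟨ solve 4 (λ g z f y → (g :+ z :* f) :* (con (+ 1) :- y :* z)
                                                := g :- z :* (y :* g) :+ z :* (f :* (con (+ 1) :- y :* z))) refl g z f y ⟩
    g - z * (y * g) + z * (f * (1# - y * z)) ≈⟨ +-congˡ (*-congˡ e) ⟩
    g - z * (y * g) + z * (y * g)          ≈⟨ solve 2 (λ g u → g :- u :+ u := g) refl g (z * (y * g)) ⟩
    g                                      ∎)

  -- Let d = uz and y = vz. Then yu = vd, so `d` divides `u`, say u = td = tuz, and cancelling `u`
  -- gives tz = 1.
  ⟂⇒coprime : ∀ {d y} → ¬ (d ≈ 0#) → d ⟂ y → Coprime d y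
  ⟂⇒coprime {d} {y} d≉0 d⟂y {z} (u , uz≈d) (v , vz≈y) with cancels d⟂y u (v , (begin
      v * d          ≈⟨ *-congˡ uz≈d ⟨
      v * (u * z)    ≈⟨ solve 3 (λ v u z → v :* (u :* z) := v :* z :* u) refl v u z ⟩
      v * z * u      ≈⟨ *-congʳ vz≈y ⟩
      y * u          ∎))
  ... | t , td≈u = t , cancel u≉0 (begin
      t * z * u      ≈⟨ solve 3 (λ t z u → t :* z :* u := t :* (u :* z)) refl t z u ⟩
      t * (u * z)    ≈⟨ *-congˡ uz≈d ⟩
      t * d          ≈⟨ td≈u ⟩
      u              ≈⟨ *-identityˡ u ⟨
      1# * u         ∎)
    where
    u≉0 : ¬ (u ≈ 0#)
    u≉0 u≈0 = d≉0 (trans (sym uz≈d) (trans (*-congʳ u≈0) (zeroˡ z)))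

-- The denominators against the modulus

module PolynomialTransversality {c ℓ : Level} (D : IntegralDomain c ℓ) where

  private
    module D = IntegralDomain D
    module T = Transversality D
    open Polynomials D
    module ≈-Reasoning = SetoidReasoning D.setoid

  open IntegralDomain polynomialDomain hiding (zero)
  open Transversality polynomialDomain
  open IntegerCoefficients commutativeRing

  coeff-constant-* : ∀ e p i → coeff (constant e * p) i D.≈ e D.* coeff p i
  coeff-constant-* e p i = D.trans (coeff-+ (e · p) (D.0# ∷ []) i)
    (D.trans (D.+-cong (coeff-· e p i) (zeros i)) (D.+-identityʳ _))
    where
    zeros : ∀ i → coeff (D.0# ∷ []) i D.≈ D.0#
    zeros zero    = D.refl
    zeros (suc i) = D.refl

  X*≈ : ∀ p → X * p ≈ (D.0# ∷ p)
  X*≈ p = ≋-trans (shift-* (constant D.1#) p) (∷-cong D.refl (*-identityˡ′ p))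

  ∷≈ : ∀ e p → (e ∷ p) ≈ constant e + X * p
  ∷≈ e p = ≋-sym (≋-trans (Polynomials.+-cong′ D (≋-refl {constant e}) (X*≈ p)) (∷-cong (D.+-identityʳ e) ≋-refl))

  constant-* : ∀ e f → constant (e D.* f) ≈ constant e * constant f
  constant-* e f = ≋-sym (∷-cong (D.+-identityʳ _) ≋-refl)

  constant-*-≈ : ∀ {e f g} → e D.* f D.≈ g → constant e * constant f ≈ constant g
  constant-*-≈ {e} {f} ef≈g = ≋-trans (≋-sym (constant-* e f)) (∷-cong ef≈g ≋-refl)

  constant-^ : ∀ e n → constant (e T.^ n) ≈ constant e ^ n
  constant-^ e zero    = ≋-refl
  constant-^ e (suc n) = ≋-trans (constant-* e (e T.^ n)) (*-congˡ {constant e} (constant-^ e n))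

  constant-≉0 : ∀ {e} → ¬ (e D.≈ D.0#) → ¬ (constant e ≈ 0#)
  constant-≉0 e≉0 e = e≉0 (coeff≈ e 0)

  coeff₀-* : ∀ p r → coeff (p * r) 0 D.≈ coeff p 0 D.* coeff r 0
  coeff₀-* []      r       = D.sym (D.zeroˡ _)
  coeff₀-* (e ∷ p) r = D.trans (coeff-+ (e · r) (D.0# ∷ p * r) 0)
    (D.trans (D.+-cong (coeff-· e r 0) D.refl) (D.+-identityʳ _))

  X≉0 : ¬ (X ≈ 0#)
  X≉0 e = D.1≉0 (coeff≈ e 1)

  X⟂constant : ∀ {e} → ¬ (e D.≈ D.0#) → X ⟂ constant e
  cancels (X⟂constant e≉0) [] _ = [] , ≋-refl
  cancels (X⟂constant {e} e≉0) (g₀ ∷ g) (f , fX≈eg) = g , ≋-trans (*-comm g X) (≋-trans (X*≈ g) (∷-cong (D.sym g₀≈0) ≋-refl))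
    where
    eg₀≈0 : e D.* g₀ D.≈ D.0#
    eg₀≈0 = D.trans (D.sym (coeff-constant-* e (g₀ ∷ g) 0))
      (D.trans (D.sym (coeff≈ fX≈eg 0)) (coeff≈ (≋-trans (*-comm f X) (X*≈ f)) 0))
    g₀≈0 : g₀ D.≈ D.0#
    g₀≈0 with D.zero-product eg₀≈0
    ... | inj₁ e≈0   = contradiction e≈0 e≉0
    ... | inj₂ g₀≈0′ = g₀≈0′

  tail : Poly → Poly
  tail []      = []
  tail (_ ∷ p) = p

  coeff-tail : ∀ p i → coeff (tail p) i D.≈ coeff p (suc i)
  coeff-tail []      i = D.refl
  coeff-tail (_ ∷ p) i = D.refl

  -- Multiplication by `X` only shifts coefficients, so the coefficients of the cofactor from index
  -- 1 on form the new cofactor.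
  constant⟂X : ∀ e → constant e ⟂ X
  cancels (constant⟂X e) g (f , fe≈Xg) = tail f , mk≋ λ i → begin
    coeff (tail f * constant e) i      ≈⟨ coeff≈ (*-comm (tail f) (constant e)) i ⟩
    coeff (constant e * tail f) i      ≈⟨ coeff-constant-* e (tail f) i ⟩
    e D.* coeff (tail f) i             ≈⟨ D.*-congˡ (coeff-tail f i) ⟩
    e D.* coeff f (suc i)              ≈⟨ coeff-constant-* e f (suc i) ⟨
    coeff (constant e * f) (suc i)     ≈⟨ coeff≈ (*-comm (constant e) f) (suc i) ⟩
    coeff (f * constant e) (suc i)     ≈⟨ coeff≈ fe≈Xg (suc i) ⟩
    coeff (X * g) (suc i)              ≈⟨ coeff≈ (X*≈ g) (suc i) ⟩
    coeff g i                          ∎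
    where open ≈-Reasoning

  -- Constant terms show that `e` divides `g₀`. Subtracting that contribution and cancelling `X`
  -- leaves the same problem for the shorter `g`.
  constant⟂ : ∀ {e} p → e T.⟂ coeff p 0 → constant e ⟂ p
  cancels (constant⟂ {e} p e⟂p₀) [] _ = [] , ≋-refl
  cancels (constant⟂ {e} p e⟂p₀) (g₀ ∷ g) (f , fe≈p*g₀g) with T.cancels e⟂p₀ g₀ (coeff f 0 T., (begin
      coeff f 0 D.* e              ≈⟨ coeff₀-* f (constant e) ⟨
      coeff (f * constant e) 0     ≈⟨ coeff≈ fe≈p*g₀g 0 ⟩
      coeff (p * (g₀ ∷ g)) 0       ≈⟨ coeff₀-* p (g₀ ∷ g) ⟩
      coeff p 0 D.* g₀             ∎))
    where open ≈-Reasoning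
  ... | h₀ T., h₀e≈g₀ with cancels (constant⟂ p e⟂p₀) g (cancels (constant⟂X e) (p * g) (f - p * constant h₀ , (begin
      (f - p * constant h₀) * constant e                          ≈⟨ solve 4 (λ f p h e → (f :- p :* h) :* e := f :* e :- p :* (h :* e)) refl f p (constant h₀) (constant e) ⟩
      f * constant e - p * (constant h₀ * constant e)             ≈⟨ +-cong fe≈p*g₀g (-‿cong (*-congˡ {p} (constant-*-≈ h₀e≈g₀))) ⟩
      p * (g₀ ∷ g) - p * constant g₀                              ≈⟨ +-congʳ (*-congˡ {p} (∷≈ g₀ g)) ⟩
      p * (constant g₀ + X * g) - p * constant g₀                 ≈⟨ solve 4 (λ p g₀ X g → p :* (g₀ :+ X :* g) :- p :* g₀ := X :* (p :* g)) refl p (constant g₀) X g ⟩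
      X * (p * g)                                                 ∎)))
    where open SetoidReasoning setoid
  ... | h , he≈g = (h₀ ∷ h) , (begin
      (h₀ ∷ h) * constant e                                       ≈⟨ *-congʳ (∷≈ h₀ h) ⟩
      (constant h₀ + X * h) * constant e                          ≈⟨ solve 4 (λ h₀ X h e → (h₀ :+ X :* h) :* e := h₀ :* e :+ X :* (h :* e)) refl (constant h₀) X h (constant e) ⟩
      constant h₀ * constant e + X * (h * constant e)             ≈⟨ +-cong (constant-*-≈ h₀e≈g₀) (*-congˡ {X} he≈g) ⟩
      constant g₀ + X * g                                         ≈⟨ ∷≈ g₀ g ⟨
      (g₀ ∷ g)                                                    ∎)
    where open SetoidReasoning setoid

  module Modulus (e : D.Carrier) (n : ℕ) where

    private
      E = constant e

    -- Here `X` plays a and `E` plays q. The exponent is a successor because the modulus has to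
    -- reduce to `X` modulo `E`.
    modulusₑ : Poly
    modulusₑ = (1# - X * E ^ suc n) * (X - E ^ suc n)

    cofactor : Poly
    cofactor = 1# - X * E ^ suc n + E ^ suc n * E ^ suc n

    modulus-at-0 : modulusₑ ≈ constant (D.- (e T.^ suc n)) + X * cofactor
    modulus-at-0 = ≋-trans
      (solve 2 (λ X Q → (con (+ 1) :- X :* Q) :* (X :- Q) := :- Q :+ X :* (con (+ 1) :- X :* Q :+ Q :* Q)) refl X (E ^ suc n))
      (+-congʳ (≋-sym (neg-cong′ (constant-^ e (suc n)))))

    X⟂modulus : ¬ (e D.≈ D.0#) → X ⟂ modulusₑ
    X⟂modulus e≉0 = ⟂-respʳ (≋-sym modulus-at-0) (⟂-shift cofactor (X⟂constant -eⁿ≉0))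
      where
      eⁿ≉0 : ∀ n → ¬ (e T.^ n D.≈ D.0#)
      eⁿ≉0 zero    = D.1≉0
      eⁿ≉0 (suc n) = D.*-nonzero e≉0 (eⁿ≉0 n)
      -eⁿ≉0 : ¬ (D.- (e T.^ suc n) D.≈ D.0#)
      -eⁿ≉0 eq = eⁿ≉0 (suc n) (D.trans (D.sym (-‿involutive _)) (D.trans (D.-‿cong eq) -0#≈0#))
        where open RingProperties D.ring using (-‿involutive; -0#≈0#)

    cofactor′ : Poly
    cofactor′ = - (E ^ n) - X * X * E ^ n + X * E ^ n * E ^ suc n

    modulus-mod-E : modulusₑ ≈ X + E * cofactor′
    modulus-mod-E = solve 3 (λ X E Q → (con (+ 1) :- X :* (E :* Q)) :* (X :- E :* Q)
      := X :+ E :* (:- Q :- X :* X :* Q :+ X :* Q :* (E :* Q))) refl X E (E ^ n)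

    E⟂modulus : E ⟂ modulusₑ
    E⟂modulus = ⟂-respʳ (≋-sym modulus-mod-E) (⟂-shift cofactor′ (constant⟂X e))

    -- By `constant⟂` the constant term of the modulus decides. Up to sign it is a power of `e`, and
    -- `e` is invertible modulo 1 - ey.
    1-E*y⟂modulus : ∀ y → 1# - E * constant y ⟂ modulusₑ
    1-E*y⟂modulus y = ⟂-respˡ (≋-trans (∷-cong D.refl ≋-refl) (+-congˡ {1#} (neg-cong′ (constant-* e y))))
      (constant⟂ modulusₑ (T.⟂-respʳ (D.sym (coeff≈ (≋-trans modulus-at-0 (≋-sym (∷≈ (D.- (e T.^ suc n)) cofactor))) 0))
        (T.⟂-neg (T.⟂-^ (suc n) (T.1-yz⟂y e y)))))

    -- This brings 1 - b^(k+1) into the form 1 - E y with a constant y.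
    b-power : ∀ k → E ^ 2 * (E ^ 2) ^ k ≈ E * constant (e D.* (e T.^ 2) T.^ k)
    b-power k = trans
      (solve 2 (λ E Y → E :* (E :* con (+ 1)) :* Y := E :* (E :* Y)) refl E ((E ^ 2) ^ k))
      (*-congˡ {E} (trans (*-congˡ {E} (trans (^-congˡ k (sym (constant-^ e 2))) (sym (constant-^ (e T.^ 2) k))))
        (sym (constant-* e ((e T.^ 2) T.^ k)))))
      where open SemiringExp semiring using (^-congˡ)

    1-b≈ : ∀ k → 1# - E * constant (e D.* (e T.^ 2) T.^ k) ≈ 1# - E ^ 2 * (E ^ 2) ^ k
    1-b≈ k = +-congˡ {1#} (-‿cong (sym (b-power k)))

    1-b⟂modulus : ∀ k → 1# - E ^ 2 * (E ^ 2) ^ k ⟂ modulusₑ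
    1-b⟂modulus k = ⟂-respˡ (1-b≈ k) (1-E*y⟂modulus (e D.* (e T.^ 2) T.^ k))

    -- If the difference vanished, its constant term would exhibit an inverse of `e`.
    1-b≉0 : (∀ y → ¬ (e D.* y D.≈ D.1#)) → ∀ k → ¬ (1# - E ^ 2 * (E ^ 2) ^ k ≈ 0#)
    1-b≉0 e-nonunit k 1-b≈0 = e-nonunit y (D.sym (D.trans
      (coeff≈ (x∙y⁻¹≈ε⇒x≈y 1# (E * constant y) (trans (1-b≈ k) 1-b≈0)) 0)
      (coeff₀-* E (constant y))))
      where
      open RingProperties ring using (x∙y⁻¹≈ε⇒x≈y)
      y : D.Carrier
      y = e D.* (e T.^ 2) T.^ k

-- Congruences with quotients in a subring

record Subring {c ℓ : Level} (K : CommutativeRing c ℓ) (s : Level) : Set (c ⊔ ℓ ⊔ lsuc s) where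
  open CommutativeRing K hiding (zero)
  open RawSemiringDefinitions (Semiring.rawSemiring semiring) using (_^_)
  field
    Member   : Carrier → Set s
    ∈-resp   : ∀ {f g} → f ≈ g → Member f → Member g
    ∈-1      : Member 1#
    ∈-+      : ∀ {f g} → Member f → Member g → Member (f + g)
    ∈-neg    : ∀ {f} → Member f → Member (- f)
    ∈-*      : ∀ {f g} → Member f → Member g → Member (f * g)

  ∈-0 : Member 0#
  ∈-0 = ∈-resp (-‿inverseʳ 1#) (∈-+ ∈-1 (∈-neg ∈-1))

  ∈-1- : ∀ {f} → Member f → Member (1# - f)
  ∈-1- f∈ = ∈-+ ∈-1 (∈-neg f∈)

  ∈-^ : ∀ {f} n → Member f → Member (f ^ n)
  ∈-^ zero    f∈ = ∈-1
  ∈-^ (suc n) f∈ = ∈-* f∈ (∈-^ n f∈)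

module SubringCongruence {c ℓ s : Level} (K : CommutativeRing c ℓ) (S : Subring K s) (π : CommutativeRing.Carrier K) where

  open CommutativeRing K hiding (zero)
  open Subring S
  open IntegerCoefficients K
  open FiniteSums K
  open SetoidReasoning setoid

  infix 4 _∼_
  -- Among fractions every element is a multiple of a nonzero `π`; membership of the quotient is
  -- what gives the congruence content.
  record _∼_ (f g : Carrier) : Set (c ⊔ ℓ ⊔ s) where
    constructor mk∼
    field
      quotient   : Carrier
      quotient∈  : Member quotient
      difference : f - g ≈ π * quotient
  open _∼_ public

  ∼-reflexive : ∀ {f g} → f ≈ g → f ∼ g
  ∼-reflexive {f} {g} f≈g = mk∼ 0# ∈-0
    (trans (+-congʳ f≈g) (trans (-‿inverseʳ g) (sym (zeroʳ π))))

  ∼-resp : ∀ {f f′ g g′} → f ≈ f′ → g ≈ g′ → f ∼ g → f′ ∼ g′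
  ∼-resp f≈f′ g≈g′ (mk∼ h h∈ e) = mk∼ h h∈ (trans (+-cong (sym f≈f′) (-‿cong (sym g≈g′))) e)

  ∼-+ : ∀ {f f′ g g′} → f ∼ f′ → g ∼ g′ → f + g ∼ f′ + g′
  ∼-+ {f} {f′} {g} {g′} (mk∼ h h∈ e) (mk∼ k k∈ e′) = mk∼ (h + k) (∈-+ h∈ k∈) (begin
    f + g - (f′ + g′)       ≈⟨ solve 4 (λ f f′ g g′ → f :+ g :- (f′ :+ g′) := (f :- f′) :+ (g :- g′)) refl f f′ g g′ ⟩
    (f - f′) + (g - g′)     ≈⟨ +-cong e e′ ⟩
    π * h + π * k           ≈⟨ distribˡ π h k ⟨
    π * (h + k)             ∎)

  -- The splitting (f - f′) g + f′ (g - g′) explains why membership is asked of `f′` and `g`.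
  ∼-* : ∀ {f f′ g g′} → Member f′ → Member g → f ∼ f′ → g ∼ g′ → f * g ∼ f′ * g′
  ∼-* {f} {f′} {g} {g′} f′∈ g∈ (mk∼ h h∈ e) (mk∼ k k∈ e′) = mk∼ (h * g + f′ * k) (∈-+ (∈-* h∈ g∈) (∈-* f′∈ k∈)) (begin
    f * g - f′ * g′                   ≈⟨ solve 4 (λ f f′ g g′ → f :* g :- f′ :* g′ := (f :- f′) :* g :+ f′ :* (g :- g′)) refl f f′ g g′ ⟩
    (f - f′) * g + f′ * (g - g′)      ≈⟨ +-cong (*-congʳ e) (*-congˡ e′) ⟩
    π * h * g + f′ * (π * k)          ≈⟨ solve 5 (λ π h g f k → π :* h :* g :+ f :* (π :* k) := π :* (h :* g :+ f :* k)) refl π h g f′ k ⟩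
    π * (h * g + f′ * k)              ∎)

  ∼-*ʳ : ∀ {f f′ g} → Member g → f ∼ f′ → f * g ∼ f′ * g
  ∼-*ʳ {f} {f′} {g} g∈ (mk∼ h h∈ e) = mk∼ (h * g) (∈-* h∈ g∈) (begin
    f * g - f′ * g    ≈⟨ solve 3 (λ f f′ g → f :* g :- f′ :* g := (f :- f′) :* g) refl f f′ g ⟩
    (f - f′) * g      ≈⟨ *-congʳ e ⟩
    π * h * g         ≈⟨ *-assoc _ _ _ ⟩
    π * (h * g)       ∎)

  ∼-∑ : ∀ n {f g : ℕ → Carrier} → (∀ k → f k ∼ g k) → ∑ n f ∼ ∑ n g
  ∼-∑ zero    e = ∼-reflexive refl
  ∼-∑ (suc n) e = ∼-+ (e 0) (∼-∑ n (λ k → e (suc k)))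

-- Elimination of a from the left-hand sum

module CongruentSums {c ℓ s : Level} (K : CommutativeRing c ℓ) (S : Subring K s)
  (a a⁻¹ q q⁻¹ x : CommutativeRing.Carrier K) where

  open CommutativeRing K hiding (zero)
  open RawSemiringDefinitions (Semiring.rawSemiring semiring) using (_^_)
  open SemiringExp semiring using (^-congʳ; ^-homo-*; ^-assocʳ)
  open IntegerCoefficients K
  open FractionArithmetic K using (power-inverse)
  open FiniteSums K
  open QSeries K (q ^ 2)
  open Subring S
  open SetoidReasoning setoid

  module Invertible
    (a∈ : Member a) (a⁻¹∈ : Member a⁻¹) (q∈ : Member q) (q⁻¹∈ : Member q⁻¹) (x∈ : Member x)
    (aa⁻¹≈1 : a * a⁻¹ ≈ 1#) (qq⁻¹≈1 : q * q⁻¹ ≈ 1#)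
    (fact⁻¹ : ℕ → Carrier) (fact⁻¹∈ : ∀ k → Member (fact⁻¹ k))
    (fact-inverse : ∀ k → fact k * fact⁻¹ k ≈ 1#)
    (m : ℕ) where

    private
      n : ℕ
      n = suc (m ℕ.+ m)

    open InvertibleFactorials fact⁻¹ fact-inverse
    open InvertibleBase (q⁻¹ ^ 2) (power-inverse qq⁻¹≈1 2)
    open Transformation m x
    open SubringCongruence K S ((1# - a * q ^ n) * (a - q ^ n))

    square-power : ∀ y k → (y ^ 2) ^ k ≈ y ^ (k ℕ.+ k)
    square-power y k = trans (^-assocʳ y 2 k) (^-congʳ y (≡.cong (k ℕ.+_) (ℕₚ.+-identityʳ k)))

    factor-∼ : ∀ i → (1# - a * q * (q ^ 2) ^ i) * (1# - q * a⁻¹ * (q ^ 2) ^ i)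
      ∼ (1# - (q ^ 2) ^ suc (m ℕ.+ i)) * (1# - (q ^ 2) ^ i * (q⁻¹ ^ 2) ^ m)
    factor-∼ i = mk∼ (q * B * a⁻¹ * V) (∈-* (∈-* (∈-* q∈ (∈-^ i (∈-^ 2 q∈))) a⁻¹∈) (∈-^ n q⁻¹∈)) (begin
      (1# - a * q * B) * (1# - q * a⁻¹ * B) - (1# - (q ^ 2) ^ suc (m ℕ.+ i)) * (1# - B * (q⁻¹ ^ 2) ^ m)
        ≈⟨ +-congˡ (-‿cong (*-cong (+-congˡ (-‿cong upper)) (+-congˡ (-‿cong (*-congˡ lower))))) ⟩
      (1# - a * q * B) * (1# - q * a⁻¹ * B) - (1# - q * Q * B) * (1# - B * (q * V))
        ≈⟨ solve 6 (λ a a⁻¹ q B Q V →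
             (con (+ 1) :- a :* q :* B) :* (con (+ 1) :- q :* a⁻¹ :* B) :- (con (+ 1) :- q :* Q :* B) :* (con (+ 1) :- B :* (q :* V))
             := q :* B :* (Q :+ V :- a :- a⁻¹) :+ q :* B :* (q :* B) :* (a :* a⁻¹ :- Q :* V)) refl a a⁻¹ q B Q V ⟩
      q * B * (Q + V - a - a⁻¹) + q * B * (q * B) * (a * a⁻¹ - Q * V)
        -- The solver treats `a⁻¹` and `V` as free variables, so a a⁻¹ = 1 and Q V = 1 enter by
        -- hand: here they delete the last summand, below they are put back until P factors out.
        ≈⟨ +-congˡ (*-congˡ (+-cong aa⁻¹≈1 (-‿cong (power-inverse qq⁻¹≈1 n)))) ⟩
      q * B * (Q + V - a - a⁻¹) + q * B * (q * B) * (1# - 1#)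
        ≈⟨ solve 6 (λ a a⁻¹ q B Q V →
             q :* B :* (Q :+ V :- a :- a⁻¹) :+ q :* B :* (q :* B) :* (con (+ 1) :- con (+ 1))
             := q :* B :* (con (+ 1) :* (con (+ 1) :* Q) :+ con (+ 1) :* V :- con (+ 1) :* (con (+ 1) :* a) :- con (+ 1) :* a⁻¹)) refl a a⁻¹ q B Q V ⟩
      q * B * (1# * (1# * Q) + 1# * V - 1# * (1# * a) - 1# * a⁻¹)
        ≈⟨ *-congˡ (+-cong (+-cong (+-cong (*-cong aa⁻¹≈1 (*-congʳ (power-inverse qq⁻¹≈1 n))) (*-congʳ aa⁻¹≈1))
             (-‿cong (*-cong aa⁻¹≈1 (*-congʳ (power-inverse qq⁻¹≈1 n))))) (-‿cong (*-congʳ (power-inverse qq⁻¹≈1 n)))) ⟨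
      q * B * (a * a⁻¹ * (Q * V * Q) + a * a⁻¹ * V - a * a⁻¹ * (Q * V * a) - Q * V * a⁻¹)
        ≈⟨ solve 6 (λ a a⁻¹ q B Q V →
             q :* B :* (a :* a⁻¹ :* (Q :* V :* Q) :+ a :* a⁻¹ :* V :- a :* a⁻¹ :* (Q :* V :* a) :- Q :* V :* a⁻¹)
             := (con (+ 1) :- a :* Q) :* (a :- Q) :* (q :* B :* a⁻¹ :* V)) refl a a⁻¹ q B Q V ⟩
      (1# - a * Q) * (a - Q) * (q * B * a⁻¹ * V) ∎)
      where
      B = (q ^ 2) ^ i
      Q = q ^ n
      V = q⁻¹ ^ n
      -- As n = 2m + 1, the exponents are 2(m+1) = n + 1 and, in `lower`, -2m = 1 - n; hence the
      -- extra `q` in both.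
      upper : (q ^ 2) ^ suc (m ℕ.+ i) ≈ q * Q * B
      upper = begin
        q ^ 2 * (q ^ 2) ^ (m ℕ.+ i)          ≈⟨ *-congˡ (^-homo-* (q ^ 2) m i) ⟩
        q ^ 2 * ((q ^ 2) ^ m * B)            ≈⟨ *-congˡ (*-congʳ (square-power q m)) ⟩
        q * (q * 1#) * (q ^ (m ℕ.+ m) * B)   ≈⟨ solve 3 (λ q M B → q :* (q :* con (+ 1)) :* (M :* B) := q :* (q :* M) :* B) refl q (q ^ (m ℕ.+ m)) B ⟩
        q * Q * B                            ∎
      lower : (q⁻¹ ^ 2) ^ m ≈ q * V
      lower = begin
        (q⁻¹ ^ 2) ^ m                        ≈⟨ square-power q⁻¹ m ⟩
        q⁻¹ ^ (m ℕ.+ m)                      ≈⟨ *-identityˡ _ ⟨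
        1# * q⁻¹ ^ (m ℕ.+ m)                 ≈⟨ *-congʳ qq⁻¹≈1 ⟨
        q * q⁻¹ * q⁻¹ ^ (m ℕ.+ m)            ≈⟨ *-assoc _ _ _ ⟩
        q * V                                ∎

    specialised∈ : ∀ k → Member (specialised k)
    specialised∈ zero    = ∈-1
    specialised∈ (suc k) = ∈-* (specialised∈ k) (∈-* (∈-1- (∈-^ (suc (m ℕ.+ k)) (∈-^ 2 q∈)))
      (∈-1- (∈-* (∈-^ k (∈-^ 2 q∈)) (∈-^ m (∈-^ 2 q⁻¹∈)))))

    poch-∼ : ∀ k → poch (a * q) k * poch (q * a⁻¹) k ∼ specialised k
    poch-∼ zero    = ∼-reflexive (*-identityˡ 1#)
    poch-∼ (suc k) = ∼-resp
      (solve 4 (λ A B u v → A :* B :* (u :* v) := A :* u :* (B :* v)) refl _ _ _ _) refl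
      (∼-* (specialised∈ k)
        (∈-* (∈-1- (∈-* (∈-* a∈ q∈) (∈-^ k (∈-^ 2 q∈)))) (∈-1- (∈-* (∈-* q∈ a⁻¹∈) (∈-^ k (∈-^ 2 q∈)))))
        (poch-∼ k) (factor-∼ k))

    -- In base q² the triangular power is q^(k²-k); the factor `q ^ k` keeps the exponents natural.
    qtri-square : ∀ k → qtri k * q ^ k ≈ q ^ (k ℕ.* k)
    qtri-square zero    = *-identityˡ 1#
    qtri-square (suc k) = begin
      (q ^ 2) ^ k * qtri k * (q * q ^ k)         ≈⟨ *-congʳ (*-congʳ (square-power q k)) ⟩
      q ^ (k ℕ.+ k) * qtri k * (q * q ^ k)       ≈⟨ *-congʳ (*-congʳ (^-homo-* q k k)) ⟩
      q ^ k * q ^ k * qtri k * (q * q ^ k)       ≈⟨ solve 3 (λ q Q t → Q :* Q :* t :* (q :* Q) := q :* (Q :* (Q :* (t :* Q)))) refl q (q ^ k) (qtri k) ⟩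
      q * (q ^ k * (q ^ k * (qtri k * q ^ k)))   ≈⟨ *-congˡ (*-congˡ (*-congˡ (qtri-square k))) ⟩
      q * (q ^ k * (q ^ k * q ^ (k ℕ.* k)))      ≈⟨ *-congˡ (*-congˡ (^-homo-* q k (k ℕ.* k))) ⟨
      q * (q ^ k * q ^ (k ℕ.+ k ℕ.* k))          ≈⟨ *-congˡ (^-homo-* q k (k ℕ.+ k ℕ.* k)) ⟨
      q * q ^ (k ℕ.+ (k ℕ.+ k ℕ.* k))            ≈⟨ *-congˡ (^-congʳ q (≡.cong (k ℕ.+_) (ℕₚ.*-suc k k))) ⟨
      q ^ (suc k ℕ.* suc k)                      ∎

    -- With n = 2m + 1, a factor q^(-k) of q^(-nk) turns q^(k²) into the triangular power, and
    -- q^(-2mk) remains.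
    weight-power : ∀ k → q ^ (k ℕ.* k) * q⁻¹ ^ (n ℕ.* k) ≈ weight m k
    weight-power k = begin
      q ^ (k ℕ.* k) * q⁻¹ ^ (k ℕ.+ (m ℕ.+ m) ℕ.* k)
        ≈⟨ *-cong (sym (qtri-square k)) (^-homo-* q⁻¹ k ((m ℕ.+ m) ℕ.* k)) ⟩
      qtri k * q ^ k * (q⁻¹ ^ k * q⁻¹ ^ ((m ℕ.+ m) ℕ.* k))
        ≈⟨ solve 4 (λ t Q V W → t :* Q :* (V :* W) := t :* (Q :* V :* W)) refl (qtri k) (q ^ k) (q⁻¹ ^ k) _ ⟩
      qtri k * (q ^ k * q⁻¹ ^ k * q⁻¹ ^ ((m ℕ.+ m) ℕ.* k))
        ≈⟨ *-congˡ (trans (*-congʳ (power-inverse qq⁻¹≈1 k)) (*-identityˡ _)) ⟩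
      qtri k * q⁻¹ ^ ((m ℕ.+ m) ℕ.* k)
        ≈⟨ *-congˡ (^-congʳ q⁻¹ (ℕₚ.*-distribʳ-+ k m m)) ⟩
      qtri k * q⁻¹ ^ (m ℕ.* k ℕ.+ m ℕ.* k)
        ≈⟨ *-congˡ (square-power q⁻¹ (m ℕ.* k)) ⟨
      weight m k ∎

    leftTerm rightTerm : ℕ → Carrier
    leftTerm  k = poch (a * q) k * poch (q * a⁻¹) k * (fact⁻¹ k * fact⁻¹ k) * x ^ k
    rightTerm k = gauss m k * gauss m k * (q ^ (k ℕ.* k) * q⁻¹ ^ (n ℕ.* k)) * (- x) ^ k * poch x (m ∸ k)

    rhsTerm≈rightTerm : ∀ k → rhsTerm m 0 k ≈ rightTerm k
    rhsTerm≈rightTerm k = *-congʳ (*-congʳ (trans (sym (*-assoc _ _ _)) (*-congˡ (sym (weight-power k)))))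

    sums-∼ : ∑ n leftTerm ∼ ∑ (suc m) rightTerm
    sums-∼ = ∼-resp refl
      (trans specialised-identity (∑-cong (suc m) (λ k _ → rhsTerm≈rightTerm k)))
      (∼-∑ n (λ k → ∼-*ʳ (∈-^ k x∈) (∼-*ʳ (∈-* (fact⁻¹∈ k) (fact⁻¹∈ k)) (poch-∼ k))))

-- Fractions with admissible denominators

module FractionLemmas {c ℓ : Level} (R : IntegralDomain c ℓ) where

  private
    module R = IntegralDomain R
    module F = Fractions R
    module T = Transversality R
  open FractionField R
  open CommutativeRing fractionRing using (sym; trans; refl; reflexive; *-congˡ; *-congʳ; *-cong; *-identityˡ; *-assoc; *-comm; +-cong; +-congˡ; -‿cong; zeroˡ)
  open FractionArithmetic fractionRing
  fromRing-* : ∀ y z → fromRing (y R.* z) ≈ fromRing y * fromRing z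
  fromRing-* y z = F.mk≃ (R.*-congˡ (R.*-identityˡ R.1#))

  fromRing-+ : ∀ y z → fromRing (y R.+ z) ≈ fromRing y + fromRing z
  fromRing-+ y z = F.mk≃ (R.*-cong (R.+-cong (R.sym (R.*-identityʳ y)) (R.sym (R.*-identityʳ z))) (R.*-identityˡ R.1#))

  fromRing-- : ∀ y z → fromRing (y R.- z) ≈ fromRing y - fromRing z
  fromRing-- y z = fromRing-+ y (R.- z)

  fromRing-^ : ∀ y n → fromRing (y T.^ n) ≈ fromRing y ^ n
  fromRing-^ y zero    = refl
  fromRing-^ y (suc n) = trans (fromRing-* y (y T.^ n)) (*-congˡ {fromRing y} (fromRing-^ y n))

  fromRing-1- : ∀ {y f} → fromRing y ≈ f → fromRing (R.1# R.- y) ≈ 1# - f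
  fromRing-1- {y} e = trans (fromRing-- R.1# y) (+-congˡ {1#} (-‿cong e))

  fromRing-≉0 : ∀ {y} → ¬ (y R.≈ R.0#) → ¬ (fromRing y ≈ 0#)
  fromRing-≉0 y≉0 (F.mk≃ e) = y≉0 (R.trans (R.sym (R.*-identityʳ _)) (R.trans e (R.zeroˡ _)))

  *-fromRing⇒≈ : ∀ {f} y d (d≉0 : ¬ (d R.≈ R.0#)) → f * fromRing d ≈ fromRing y → f ≈ mkFraction y d d≉0
  *-fromRing⇒≈ {mkFraction n k _} y d d≉0 (F.mk≃ e) = F.mk≃
    (R.trans (R.sym (R.*-identityʳ _)) (R.trans e (R.*-congˡ (R.*-identityʳ k))))

  -- A right inverse excludes `f ≈ 0#` and with it the default value of `_⁻¹`; reciprocals of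
  -- products and powers are computed this way.
  ⁻¹-unique : ∀ {f g} → f * g ≈ 1# → f ⁻¹ ≈ g
  ⁻¹-unique {f} {g} fg≈1 = inverse-unique {f} {f ⁻¹} {g} (F.⁻¹-inverseʳ f f≉0) fg≈1
    where
    f≉0 : ¬ (f ≈ 0#)
    f≉0 f≈0 = fromRing-≉0 R.1≉0 (trans (sym fg≈1) (trans (*-congʳ {g} f≈0) (zeroˡ g)))

  module _ (P : R.Carrier) where

    -- The denominator is a separate witness, not the stored one: fractions are unreduced, and
    -- membership has to respect `≈`.
    record Local (f : Fraction) : Set (c ⊔ ℓ) where
      constructor mkLocal
      field
        numerator denominator : R.Carrier
        denominator≉0         : ¬ (denominator R.≈ R.0#)
        denominator⟂P         : denominator T.⟂ P
        cleared               : f * fromRing denominator ≈ fromRing numerator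

    local-fromRing : ∀ y → Local (fromRing y)
    local-fromRing y = mkLocal y R.1# R.1≉0 (T.1⟂ P) (trans (*-comm (fromRing y) 1#) (*-identityˡ (fromRing y)))

    local-inverse : ∀ {f d} → ¬ (d R.≈ R.0#) → d T.⟂ P → fromRing d * f ≈ 1# → Local f
    local-inverse {f} {d} d≉0 d⟂P e = mkLocal R.1# d d≉0 d⟂P (trans (*-comm f (fromRing d)) e)

    -- This is the localisation of the domain at the nonzero elements transversal to `P`, which
    -- `⟂-*ˡ` makes a multiplicative set.
    localSubring : Subring fractionRing (c ⊔ ℓ)
    localSubring = record
      { Member = Local
      ; ∈-resp = λ { {f} {g} f≈g (mkLocal y d d≉0 d⟂P e) →
          mkLocal y d d≉0 d⟂P (trans (*-congʳ {fromRing d} (sym f≈g)) e) }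
      ; ∈-1    = local-fromRing R.1#
      ; ∈-+    = λ { {f} {g} (mkLocal y d d≉0 d⟂P e) (mkLocal y′ d′ d′≉0 d′⟂P e′) →
          mkLocal (y R.* d′ R.+ y′ R.* d) (d R.* d′) (R.*-nonzero d≉0 d′≉0) (T.⟂-*ˡ d≉0 d⟂P d′⟂P)
            (trans (*-congˡ {f + g} (fromRing-* d d′)) (trans
              (add-fractions {f} {g} {fromRing d} {fromRing d′} {fromRing y} {fromRing y′} e e′)
              (sym (trans (fromRing-+ (y R.* d′) (y′ R.* d)) (+-cong (fromRing-* y d′) (fromRing-* y′ d)))))) }
      ; ∈-neg  = λ { {f} (mkLocal y d d≉0 d⟂P e) →
          mkLocal (R.- y) d d≉0 d⟂P (negate-fraction {f} {fromRing d} {fromRing y} e) }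
      ; ∈-*    = λ { {f} {g} (mkLocal y d d≉0 d⟂P e) (mkLocal y′ d′ d′≉0 d′⟂P e′) →
          mkLocal (y R.* y′) (d R.* d′) (R.*-nonzero d≉0 d′≉0) (T.⟂-*ˡ d≉0 d⟂P d′⟂P)
            (trans (*-congˡ {f * g} (fromRing-* d d′)) (trans
              (multiply-fractions {f} {g} {fromRing d} {fromRing d′} {fromRing y} {fromRing y′} e e′)
              (sym (fromRing-* y y′)))) }
      }

    local-multiple⇒≡mod : ∀ {A B h} → Local h → A - B ≈ fromRing P * h → A ≡ B [mod P ]
    local-multiple⇒≡mod {A} {B} {h} (mkLocal y d d≉0 d⟂P e) A-B≈Ph =
      y , d , d≉0 , T.⟂⇒coprime d≉0 d⟂P , *-fromRing⇒≈ {A - B} (P R.* y) d d≉0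
        (trans (*-congʳ {fromRing d} A-B≈Ph) (trans (*-assoc (fromRing P) h (fromRing d))
          (trans (*-congˡ {fromRing P} e) (sym (fromRing-* P y)))))

  module QCalculus (b : Fraction) where

    open QSeries fractionRing b

    poch≈qShifted : ∀ y k → poch y k ≈ qShifted y b k
    poch≈qShifted y zero    = refl
    poch≈qShifted y (suc k) = *-congʳ {1# - y * b ^ k} (poch≈qShifted y k)

    qShifted-inverse : ∀ (fact-≉0 : ∀ k → ¬ (fact k ≈ 0#)) k → fact k * qShifted b b k ⁻¹ ≈ 1#
    qShifted-inverse fact-≉0 k = trans (*-congʳ {qShifted b b k ⁻¹} (poch≈qShifted b k))
      (F.⁻¹-inverseʳ (qShifted b b k) (λ e → fact-≉0 k (trans (poch≈qShifted b k) e)))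

    qBinomial≈gauss : (∀ k → ¬ (fact k ≈ 0#)) → ∀ {N k} → k ≤ N → qBinomial N k b ≈ gauss N k
    -- The test `does (k ≤? N)` computes to `k ≤ᵇ N`, so this match selects the quotient of
    -- factorials.
    qBinomial≈gauss fact-≉0 {N} {k} k≤N with k ℕ.≤ᵇ N | ℕₚ.≤⇒≤ᵇ k≤N
    ... | true | _ = trans (*-cong (sym (poch≈qShifted b N)) (⁻¹-unique {S k * S (N ∸ k)} {S k ⁻¹ * S (N ∸ k) ⁻¹} product-inverse))
      (sym (≡.subst (λ M → gauss M k ≈ fact M * (S k ⁻¹ * S (N ∸ k) ⁻¹)) (ℕₚ.m+[n∸m]≡n k≤N)
        (InvertibleFactorials.gauss-formula (λ j → S j ⁻¹) (qShifted-inverse fact-≉0) k (N ∸ k))))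
      where
      S : ℕ → Fraction
      S = qShifted b b
      inverse : ∀ j → S j * S j ⁻¹ ≈ 1#
      inverse j = trans (*-congʳ {S j ⁻¹} (sym (poch≈qShifted b j))) (qShifted-inverse fact-≉0 j)
      product-inverse : S k * S (N ∸ k) * (S k ⁻¹ * S (N ∸ k) ⁻¹) ≈ 1#
      product-inverse = trans (multiply-fractions {S k} {S (N ∸ k)} {S k ⁻¹} {S (N ∸ k) ⁻¹} {1#} {1#} (inverse k) (inverse (N ∸ k)))
        (*-identityˡ 1#)

  -- Cancelling successors in i ⊖ j matches cancelling pairs f g = 1, so the sign of the exponent is
  -- decided only in the base cases.
  ^ℤ-⊖ : ∀ {f g} → f * g ≈ 1# → ∀ i j → f ^ℤ (i ℤ.⊖ j) ≈ f ^ i * g ^ j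
  ^ℤ-⊖ {f} {g} fg≈1 i       zero    = sym (trans (*-comm (f ^ i) 1#) (*-identityˡ (f ^ i)))
  ^ℤ-⊖ {f} {g} fg≈1 zero    (suc j) = trans
    (⁻¹-unique {f ^ suc j} {g ^ suc j} (power-inverse {f} {g} fg≈1 (suc j))) (sym (*-identityˡ (g ^ suc j)))
  ^ℤ-⊖ {f} {g} fg≈1 (suc i) (suc j) = trans (reflexive (≡.cong (f ^ℤ_) (ℤₚ.[1+m]⊖[1+n]≡m⊖n i j)))
    (trans (^ℤ-⊖ fg≈1 i j) (sym (trans (interchange f (f ^ i) g (g ^ j))
      (trans (*-congʳ {f ^ i * g ^ j} fg≈1) (*-identityˡ (f ^ i * g ^ j))))))

-- The congruence over an arbitrary integral domain

module CongruenceStatement {c ℓ : Level} (R : IntegralDomain c ℓ) where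

  open FractionField R

  -- Keeping `m` apart from `n` allows m and (n-1)/2 to be exchanged by substitution.
  Congruent : (a q x : Fraction) (P : IntegralDomain.Carrier R) (n m : ℕ) → Set (c ⊔ ℓ)
  Congruent a q x P n m =
    sum {n} (λ i → let k = toℕ i in
      qShifted (a * q) (q ^ 2) k * qShifted (q / a) (q ^ 2) k / (qShifted (q ^ 2) (q ^ 2) k ^ 2) * x ^ k)
    ≡
    sum {suc m} (λ i → let k = toℕ i in
      qBinomial m k (q ^ 2) ^ 2 * q ^ℤ (+ (k ℕ.* k) ℤ.- + (n ℕ.* k)) * (- x) ^ k * qShifted x (q ^ 2) (m ∸ k))
    [mod P ]

module CongruenceTheorem {c ℓ : Level} (R : IntegralDomain c ℓ) (aₚ qₚ xₚ : IntegralDomain.Carrier R) (m : ℕ) where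

  private
    module R = IntegralDomain R
    module T = Transversality R
    n : ℕ
    n = suc (m ℕ.+ m)
  open FractionField R
  open FractionLemmas R
  open FractionArithmetic fractionRing
  open CommutativeRing fractionRing using (sym; trans; refl; reflexive; *-congˡ; *-congʳ; *-cong; *-identityʳ; +-cong; +-congˡ; -‿cong)
  open SemiringExp semiring using (^-congˡ)
  open FiniteSums fractionRing using (∑; ∑-cong)

  P : R.Carrier
  P = (R.1# R.- aₚ R.* qₚ T.^ n) R.* (aₚ R.- qₚ T.^ n)

  private
    a q x b : Fraction
    a = fromRing aₚ
    q = fromRing qₚ
    x = fromRing xₚ
    b = q ^ 2
    bₚ : R.Carrier
    bₚ = qₚ T.^ 2

  open QSeries fractionRing b using (poch; fact; gauss)
  open QCalculus b

  leftSummand rightSummand : ℕ → Fraction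
  leftSummand k =
    qShifted (a * q) (q ^ 2) k * qShifted (q / a) (q ^ 2) k / (qShifted (q ^ 2) (q ^ 2) k ^ 2) * x ^ k
  rightSummand k =
    qBinomial m k (q ^ 2) ^ 2 * q ^ℤ (+ (k ℕ.* k) ℤ.- + (n ℕ.* k)) * (- x) ^ k * qShifted x (q ^ 2) (m ∸ k)

  module _
    (aₚ≉0 : ¬ (aₚ R.≈ R.0#)) (aₚ⟂P : aₚ T.⟂ P)
    (qₚ≉0 : ¬ (qₚ R.≈ R.0#)) (qₚ⟂P : qₚ T.⟂ P)
    (1-b≉0 : ∀ k → ¬ (R.1# R.- bₚ R.* bₚ T.^ k R.≈ R.0#))
    (1-b⟂P : ∀ k → R.1# R.- bₚ R.* bₚ T.^ k T.⟂ P) where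

    -- The denominators are formed inside the domain, where transversality to `P` makes sense;
    -- `fromRing-fact` identifies their images.
    factₚ : ℕ → R.Carrier
    factₚ = QSeries.fact R.commutativeRing bₚ

    factₚ≉0 : ∀ k → ¬ (factₚ k R.≈ R.0#)
    factₚ≉0 zero    = R.1≉0
    factₚ≉0 (suc k) = R.*-nonzero (factₚ≉0 k) (1-b≉0 k)

    factₚ⟂P : ∀ k → factₚ k T.⟂ P
    factₚ⟂P zero    = T.1⟂ P
    factₚ⟂P (suc k) = T.⟂-*ˡ (factₚ≉0 k) (factₚ⟂P k) (1-b⟂P k)

    fromRing-b : ∀ k → fromRing (bₚ R.* bₚ T.^ k) ≈ b * b ^ k
    fromRing-b k = trans (fromRing-* bₚ (bₚ T.^ k)) (*-cong (fromRing-^ qₚ 2)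
      (trans (fromRing-^ bₚ k) (^-congˡ k (fromRing-^ qₚ 2))))

    fromRing-fact : ∀ k → fromRing (factₚ k) ≈ fact k
    fromRing-fact zero    = refl
    fromRing-fact (suc k) = trans (fromRing-* (factₚ k) (R.1# R.- bₚ R.* bₚ T.^ k))
      (*-cong (fromRing-fact k) (fromRing-1- (fromRing-b k)))

    fact≉0 : ∀ k → ¬ (fact k ≈ 0#)
    fact≉0 k e = fromRing-≉0 (factₚ≉0 k) (trans (fromRing-fact k) e)

    fact⁻¹ : ℕ → Fraction
    fact⁻¹ k = qShifted b b k ⁻¹

    fact-inverse : ∀ k → fact k * fact⁻¹ k ≈ 1#
    fact-inverse = qShifted-inverse fact≉0

    fact⁻¹-local : ∀ k → Local P (fact⁻¹ k)
    fact⁻¹-local k = local-inverse P {fact⁻¹ k} (factₚ≉0 k) (factₚ⟂P k)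
      (trans (*-congʳ {fact⁻¹ k} (fromRing-fact k)) (fact-inverse k))

    a-inverse : a * a ⁻¹ ≈ 1#
    a-inverse = Fractions.⁻¹-inverseʳ R a (fromRing-≉0 aₚ≉0)

    q-inverse : q * q ⁻¹ ≈ 1#
    q-inverse = Fractions.⁻¹-inverseʳ R q (fromRing-≉0 qₚ≉0)

    fromRing-P : fromRing P ≈ (1# - a * q ^ n) * (a - q ^ n)
    fromRing-P = trans (fromRing-* (R.1# R.- aₚ R.* qₚ T.^ n) (aₚ R.- qₚ T.^ n)) (*-cong
      (fromRing-1- (trans (fromRing-* aₚ (qₚ T.^ n)) (*-congˡ {a} (fromRing-^ qₚ n))))
      (trans (fromRing-- aₚ (qₚ T.^ n)) (+-congˡ {a} (-‿cong (fromRing-^ qₚ n)))))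

    leftSummand≈ : ∀ k →
      poch (a * q) k * poch (q * a ⁻¹) k * (fact⁻¹ k * fact⁻¹ k) * x ^ k ≈ leftSummand k
    leftSummand≈ k = *-congʳ {x ^ k} (*-cong
      (*-cong (poch≈qShifted (a * q) k) (poch≈qShifted (q / a) k))
      (sym (⁻¹-unique {qShifted b b k ^ 2} {fact⁻¹ k * fact⁻¹ k}
        (square-inverse {qShifted b b k} {fact⁻¹ k}
          (trans (*-congʳ {fact⁻¹ k} (sym (poch≈qShifted b k))) (fact-inverse k))))))

    rightSummand≈ : ∀ k → k < suc m →
      gauss m k * gauss m k * (q ^ (k ℕ.* k) * (q ⁻¹) ^ (n ℕ.* k)) * (- x) ^ k * poch x (m ∸ k) ≈ rightSummand k
    rightSummand≈ k (s≤s k≤m) = *-cong (*-congʳ {(- x) ^ k} (*-cong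
        (*-cong (sym G) (trans (sym G) (sym (*-identityʳ (qBinomial m k b)))))
        (sym (trans (reflexive (≡.cong (q ^ℤ_) (ℤₚ.m-n≡m⊖n (k ℕ.* k) (n ℕ.* k))))
          (^ℤ-⊖ {q} {q ⁻¹} q-inverse (k ℕ.* k) (n ℕ.* k))))))
      (poch≈qShifted x (m ∸ k))
      where
      G : qBinomial m k b ≈ gauss m k
      G = qBinomial≈gauss fact≉0 k≤m

    private
      module Sums = CongruentSums.Invertible fractionRing (localSubring P) a (a ⁻¹) q (q ⁻¹) x
        (local-fromRing P aₚ) (local-inverse P {a ⁻¹} aₚ≉0 aₚ⟂P a-inverse)
        (local-fromRing P qₚ) (local-inverse P {q ⁻¹} qₚ≉0 qₚ⟂P q-inverse)
        (local-fromRing P xₚ) a-inverse q-inverse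
        fact⁻¹ fact⁻¹-local fact-inverse m
      open SubringCongruence fractionRing (localSubring P) ((1# - a * q ^ n) * (a - q ^ n)) using (quotient; quotient∈; difference)
      h : Fraction
      h = quotient Sums.sums-∼

    left-sum : ∑ n leftSummand ≈ ∑ n Sums.leftTerm
    left-sum = ∑-cong n {leftSummand} {Sums.leftTerm} (λ k _ → sym (leftSummand≈ k))

    right-sum : ∑ (suc m) rightSummand ≈ ∑ (suc m) Sums.rightTerm
    right-sum = ∑-cong (suc m) {rightSummand} {Sums.rightTerm} (λ k k<1+m → sym (rightSummand≈ k k<1+m))

    sums-difference : ∑ n leftSummand - ∑ (suc m) rightSummand ≈ fromRing P * h
    sums-difference = trans
      (+-cong {∑ n leftSummand} {∑ n Sums.leftTerm} { - ∑ (suc m) rightSummand} { - ∑ (suc m) Sums.rightTerm}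
        left-sum (-‿cong {∑ (suc m) rightSummand} {∑ (suc m) Sums.rightTerm} right-sum))
      (trans (difference Sums.sums-∼) (*-congʳ {h} (sym fromRing-P)))

    congruence : CongruenceStatement.Congruent R a q x P n m
    congruence = local-multiple⇒≡mod P {∑ n leftSummand} {∑ (suc m) rightSummand} {h} (quotient∈ Sums.sums-∼) sums-difference

-- Odd n and the indeterminates a, q, x

open import Data.Nat.Divisibility using (_∣_; ∣m∣n⇒∣m+n; divides-refl; ∣-refl)

odd⇒1+m+m : ∀ n → ¬ (2 ∣ n) → ∃[ m ] n ≡ suc (m ℕ.+ m)
odd⇒1+m+m zero          2∤n = contradiction (divides-refl 0) 2∤n
odd⇒1+m+m (suc zero)    2∤n = 0 , ≡.refl
odd⇒1+m+m (suc (suc n)) 2∤n with odd⇒1+m+m n (λ 2∣n → 2∤n (∣m∣n⇒∣m+n ∣-refl 2∣n))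
... | m , ≡.refl = suc m , ≡.cong (λ k → suc (suc k)) (≡.sym (ℕₚ.+-suc m m))

m+m/2 : ∀ m → (m ℕ.+ m) ℕ./ 2 ≡ m
m+m/2 m = ≡.trans (≡.cong (ℕ._/ 2) (≡.trans (≡.cong (m ℕ.+_) (≡.sym (ℕₚ.+-identityʳ m))) (ℕₚ.*-comm 2 m))) (m*n/n≡m m 2)

module IndeterminateQ where

  private
    module ℚ[q]   = IntegralDomain ℚ[q]
    module ℚ[q,x] = IntegralDomain ℚ[q,x]
  open Polynomials using (X; constant; coeff; _≋_)
  open PolynomialTransversality using (constant-≉0; X≉0; coeff₀-*)

  qₓ : ℚ[q,x].Carrier
  qₓ = constant ℚ[q] (X ℚ-integralDomain)

  qₓ≉0 : ¬ (qₓ ℚ[q,x].≈ ℚ[q,x].0#)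
  qₓ≉0 = constant-≉0 ℚ[q] (X≉0 ℚ-integralDomain)

  -- Setting x and then q to zero would turn q y = 1 into 0 = 1 in ℚ.
  qₓ-nonunit : ∀ y → ¬ (qₓ ℚ[q,x].* y ℚ[q,x].≈ ℚ[q,x].1#)
  qₓ-nonunit y e = IntegralDomain.1≉0 ℚ-integralDomain (≡.trans (≡.sym (_≋_.coeff≈ e₀ 0))
    (≡.trans (coeff₀-* ℚ-integralDomain (X ℚ-integralDomain) y₀)
      (IntegralDomain.zeroˡ ℚ-integralDomain (coeff ℚ-integralDomain y₀ 0))))
    where
    y₀ : ℚ[q].Carrier
    y₀ = coeff ℚ[q] y 0
    e₀ : X ℚ-integralDomain ℚ[q].* y₀ ℚ[q].≈ ℚ[q].1#
    e₀ = ℚ[q].trans (ℚ[q].sym (coeff₀-* ℚ[q] qₓ y)) (_≋_.coeff≈ e 0)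

open IndeterminateQ
open RationalFunctions

Congruent : ℕ → ℕ → Set
Congruent n m = CongruenceStatement.Congruent ℚ[a,q,x] a q x (modulus n) n m

-- Since a is the variable `X` over ℚ[q,x] and q the constant `qₓ`, the modulus is `modulusₑ` by
-- definition.
congruent : ∀ m → Congruent (suc (m ℕ.+ m)) m
congruent m = CongruenceTheorem.congruence ℚ[a,q,x] aₚ qₚ xₚ m
  X≉0 (X⟂modulus qₓ≉0) (constant-≉0 qₓ≉0) E⟂modulus (1-b≉0 qₓ-nonunit) 1-b⟂modulus
  where
  open PolynomialTransversality ℚ[q,x]
  -- `Modulus` raises its argument by one, so `m + m` yields the exponent 2m + 1.
  open Modulus qₓ (m ℕ.+ m)

congruent-at : ∀ n m → n ≡ suc (m ℕ.+ m) → Congruent n ((n ∸ 1) ℕ./ 2)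
congruent-at n m ≡.refl = ≡.subst (Congruent n) (≡.sym (m+m/2 m)) (congruent m)

theorem4p1 : (n : ℕ) → 0 < n → ¬ (2 ∣ n) →
    let m = (n ∸ 1) ℕ./ 2 in
    sum {n} (λ i → let k = toℕ i in
    qShifted (a * q) (q ^ 2) k * qShifted (q / a) (q ^ 2) k / (qShifted (q ^ 2) (q ^ 2) k ^ 2) * x ^ k)
    ≡
    sum {suc m} (λ i → let k = toℕ i in
    qBinomial m k (q ^ 2) ^ 2 * q ^ℤ (+ (k ℕ.* k) ℤ.- + (n ℕ.* k)) * (- x) ^ k * qShifted x (q ^ 2) (m ∸ k))
    [mod modulus n ]
theorem4p1 n _ 2∤n = congruent-at n (proj₁ (odd⇒1+m+m n 2∤n)) (proj₂ (odd⇒1+m+m n 2∤n))
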